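{- Let $0<\epsilon<\frac12$. Every $n$-vertex digraph $G$ with minimum outdegree at least $$2\epsilon^{ -2}(2-\epsilon)\log\left(\frac{1-\epsilon}{\epsilon}\right)$$ contains a stable set of at least $\left(\frac12-\epsilon\right)n$ vertices.
   Context: Digraphs are finite, with no loops and no parallel arcs (a pair of oppositely directed arcs $uv$ and $vu$ is allowed). $\log$ denotes the natural logarithm. A set $T$ of vertices in a digraph $G$ is a stable set if for each vertex $v\in T$, at most half the out-neighbours of $v$ (in $G$) are also in $T$. (This is not the usual notion of an independent set.) -}

module Defs where

open import Data.Bool using (Bool; false)
open import Data.Fin using (Fin)
open import Data.Fin.Subset using (Subset; _∈_; _∩_) renaming (∣_∣ to card)
open import Data.Integer as ℤ using (+_; -[1+_])
import Data.Integer.Properties as ℤ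
open import Data.Nat as ℕ using (ℕ; zero; suc)
import Data.Nat.Properties as ℕ
open import Data.Product using (_×_; _,_; ∃; proj₁; proj₂)
open import Data.Rational
open import Data.Rational.Properties
open import Data.Rational.Solver using (module +-*-Solver)
import Data.Rational.Unnormalised as ℚᵘ
import Data.Rational.Unnormalised.Properties as ℚᵘ
open import Data.Sum using (inj₁; inj₂)
open import Data.Vec using (tabulate)
open import Relation.Binary.PropositionalEquality
open import Relation.Nullary using (yes; no; contradiction)
open +-*-Solver using (solve; _:=_; _:+_; _:*_; _:-_; :-_; con)

ι : ℕ → ℚ
ι zero    = 0ℚ
ι (suc n) = 1ℚ + ι n

-- Total reciprocal, with the junk value 0 at 0.
inv : ℚ → ℚ
inv q with q ≟ 0ℚ
... | yes _   = 0ℚ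
... | no  q≢0 = (1/ q) {{≢-nonZero q≢0}}

Σ< : ℕ → (ℕ → ℚ) → ℚ
Σ< zero    f = 0ℚ
Σ< (suc n) f = Σ< n f + f n

0<1 : 0ℚ < 1ℚ
0<1 = positive⁻¹ 1ℚ

*-pos : ∀ {p q} → 0ℚ < p → 0ℚ < q → 0ℚ < p * q
*-pos {p} {q} 0<p 0<q =
  positive⁻¹ (p * q) {{pos*pos⇒pos p {{positive 0<p}} q {{positive 0<q}}}}

*-nonNeg : ∀ {p q} → 0ℚ ≤ p → 0ℚ ≤ q → 0ℚ ≤ p * q
*-nonNeg {p} {q} 0≤p 0≤q =
  nonNegative⁻¹ (p * q) {{nonNeg*nonNeg⇒nonNeg p {{nonNegative 0≤p}} q {{nonNegative 0≤q}}}}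

*-mono : ∀ {a b c d} → 0ℚ ≤ a → 0ℚ ≤ d → a ≤ b → c ≤ d → a * c ≤ b * d
*-mono {a} {b} {c} {d} 0≤a 0≤d a≤b c≤d =
  ≤-trans (*-monoˡ-≤-nonNeg a {{nonNegative 0≤a}} c≤d)
          (*-monoʳ-≤-nonNeg d {{nonNegative 0≤d}} a≤b)

0≤ι : ∀ n → 0ℚ ≤ ι n
0≤ι zero    = ≤-refl
0≤ι (suc n) = +-mono-≤ (<⇒≤ 0<1) (0≤ι n)

0<ι : ∀ n → 0ℚ < ι (suc n)
0<ι n = +-mono-<-≤ 0<1 (0≤ι n)

ι-+ : ∀ m n → ι (m ℕ.+ n) ≡ ι m + ι n
ι-+ zero    n = sym (+-identityˡ (ι n))
ι-+ (suc m) n = trans (cong (_+_ 1ℚ) (ι-+ m n)) (sym (+-assoc 1ℚ (ι m) (ι n)))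

ι-* : ∀ m n → ι (m ℕ.* n) ≡ ι m * ι n
ι-* zero    n = sym (*-zeroˡ (ι n))
ι-* (suc m) n = trans (ι-+ n (m ℕ.* n)) (trans (cong (_+_ (ι n)) (ι-* m n))
  (solve 2 (λ a b → b :+ a :* b := (con 1ℚ :+ a) :* b) refl (ι m) (ι n)))

ι-mono : ∀ {m n} → m ℕ.≤ n → ι m ≤ ι n
ι-mono {n = n} ℕ.z≤n = 0≤ι n
ι-mono (ℕ.s≤s m≤n) = +-monoʳ-≤ 1ℚ (ι-mono m≤n)

ι-toℚᵘ : ∀ n → toℚᵘ (ι n) ℚᵘ.≃ ℚᵘ.mkℚᵘ (+ n) 0
ι-toℚᵘ zero    = ℚᵘ.≃-refl
ι-toℚᵘ (suc n) = ℚᵘ.≃-trans (toℚᵘ-homo-+ 1ℚ (ι n))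
  (ℚᵘ.≃-trans (ℚᵘ.+-congʳ (toℚᵘ 1ℚ) (ι-toℚᵘ n))
    (ℚᵘ.*≡* (cong (λ k → (+ 1 ℤ.+ k) ℤ.* + 1) (ℤ.*-identityʳ (+ n)))))

archimedean : ∀ q → ∃ λ n → q ≤ ι n
archimedean q@(mkℚ m d _) = ℤ.∣ m ∣ , toℚᵘ-cancel-≤
  (ℚᵘ.≤-respʳ-≃ (ℚᵘ.≃-sym (ι-toℚᵘ ℤ.∣ m ∣)) (ℚᵘ.*≤* (bound m)))
  where
  bound : ∀ m → m ℤ.* + 1 ℤ.≤ + ℤ.∣ m ∣ ℤ.* + (suc d)
  bound (+ k)    = subst₂ ℤ._≤_ (ℤ.pos-* k 1) (ℤ.pos-* k (suc d))
    (ℤ.+≤+ (ℕ.*-monoʳ-≤ k (ℕ.s≤s ℕ.z≤n)))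
  bound -[1+ k ] = ℤ.-≤+

inv-inverseʳ : ∀ {q} → 0ℚ < q → q * inv q ≡ 1ℚ
inv-inverseʳ {q} 0<q with q ≟ 0ℚ
... | yes q≡0 = contradiction (sym q≡0) (<⇒≢ 0<q)
... | no  q≢0 = *-inverseʳ q {{≢-nonZero q≢0}}

inv-pos : ∀ {q} → 0ℚ < q → 0ℚ < inv q
inv-pos {q} 0<q with q ≟ 0ℚ
... | yes q≡0 = contradiction (sym q≡0) (<⇒≢ 0<q)
... | no  q≢0 = positive⁻¹ ((1/ q) {{≢-nonZero q≢0}}) {{1/pos⇒pos q {{positive 0<q}}}}

inv-anti : ∀ {p q} → 0ℚ < p → p ≤ q → inv q ≤ inv p
inv-anti {p} {q} 0<p p≤q = subst₂ _≤_ lhs rhs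
  (*-monoʳ-≤-nonNeg (inv p * inv q)
    {{nonNegative (<⇒≤ (*-pos (inv-pos 0<p) (inv-pos 0<q)))}} p≤q)
  where
  0<q = <-≤-trans 0<p p≤q
  lhs : p * (inv p * inv q) ≡ inv q
  lhs = trans (sym (*-assoc p (inv p) (inv q)))
    (trans (cong (_* inv q) (inv-inverseʳ 0<p)) (*-identityˡ (inv q)))
  rhs : q * (inv p * inv q) ≡ inv p
  rhs = trans (solve 3 (λ a b c → a :* (b :* c) := (a :* c) :* b) refl q (inv p) (inv q))
    (trans (cong (_* inv p) (inv-inverseʳ 0<q)) (*-identityˡ (inv p)))

-- h / (1 + kh) − h' / (1 + kh') = (h − h') / ((1 + kh)(1 + kh'))
quotient-diff : ∀ h h' k {p p'} → p ≡ 1ℚ + k * h → p' ≡ 1ℚ + k * h' → 0ℚ < p → 0ℚ < p' →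
                h * inv p - h' * inv p' ≡ (h - h') * (inv p * inv p')
quotient-diff h h' k {p} {p'} refl refl 0<p 0<p' = sym (begin
  (h - h') * (i * i')
    ≡⟨ solve 5 (λ h h' k i i' → (h :- h') :* (i :* i') :=
         h :* i :* ((con 1ℚ :+ k :* h') :* i') :- h' :* i' :* ((con 1ℚ :+ k :* h) :* i))
         refl h h' k i i' ⟩
  h * i * (p' * i') - h' * i' * (p * i)
    ≡⟨ cong₂ (λ x y → h * i * x - h' * i' * y) (inv-inverseʳ 0<p') (inv-inverseʳ 0<p) ⟩
  h * i * 1ℚ - h' * i' * 1ℚ
    ≡⟨ cong₂ _-_ (*-identityʳ (h * i)) (*-identityʳ (h' * i')) ⟩
  h * i - h' * i' ∎)
  where
  open ≡-Reasoning
  i = inv p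
  i' = inv p'

inv-diff : ∀ {a b} → 0ℚ < a → 0ℚ < b → inv a - inv b ≡ (b - a) * (inv a * inv b)
inv-diff {a} {b} 0<a 0<b = sym (begin
  (b - a) * (inv a * inv b)
    ≡⟨ solve 4 (λ a b i j → (b :- a) :* (i :* j) := i :* (b :* j) :- j :* (a :* i))
         refl a b (inv a) (inv b) ⟩
  inv a * (b * inv b) - inv b * (a * inv a)
    ≡⟨ cong₂ (λ x y → inv a * x - inv b * y) (inv-inverseʳ 0<b) (inv-inverseʳ 0<a) ⟩
  inv a * 1ℚ - inv b * 1ℚ
    ≡⟨ cong₂ _-_ (*-identityʳ (inv a)) (*-identityʳ (inv b)) ⟩
  inv a - inv b ∎)
  where open ≡-Reasoning

∣-∣-sym : ∀ p q → ∣ p - q ∣ ≡ ∣ q - p ∣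
∣-∣-sym p q = trans (cong ∣_∣ (solve 2 (λ p q → p :- q := :- (q :- p)) refl p q)) (∣-p∣≡∣p∣ (q - p))

∣-∣-triangle : ∀ p q r → ∣ p - r ∣ ≤ ∣ p - q ∣ + ∣ q - r ∣
∣-∣-triangle p q r = subst (λ z → ∣ z ∣ ≤ ∣ p - q ∣ + ∣ q - r ∣)
  (solve 3 (λ p q r → (p :- q) :+ (q :- r) := p :- r) refl p q r)
  (∣p+q∣≤∣p∣+∣q∣ (p - q) (q - r))

p≤∣p∣ : ∀ p → p ≤ ∣ p ∣
p≤∣p∣ p with ≤-total 0ℚ p
... | inj₁ 0≤p = ≤-reflexive (sym (0≤p⇒∣p∣≡p 0≤p))
... | inj₂ p≤0 = ≤-trans p≤0 (0≤∣p∣ p)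

∣inv∣≤ : ∀ {δ p} → 0ℚ < δ → δ ≤ p → ∣ inv p ∣ ≤ inv δ
∣inv∣≤ 0<δ δ≤p = ≤-trans
  (≤-reflexive (0≤p⇒∣p∣≡p (<⇒≤ (inv-pos (<-≤-trans 0<δ δ≤p))))) (inv-anti 0<δ δ≤p)

scaled-by-invs : ∀ {δ p q} x → 0ℚ < δ → δ ≤ p → δ ≤ q →
                 ∣ x * (inv p * inv q) ∣ ≤ ∣ x ∣ * (inv δ * inv δ)
scaled-by-invs {δ} {p} {q} x 0<δ δ≤p δ≤q = ≤-trans
  (≤-reflexive (trans (∣p*q∣≡∣p∣*∣q∣ x (inv p * inv q))
    (cong (∣ x ∣ *_) (∣p*q∣≡∣p∣*∣q∣ (inv p) (inv q)))))
  (*-monoˡ-≤-nonNeg ∣ x ∣ {{∣-∣-nonNeg x}}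
    (*-mono (0≤∣p∣ (inv p)) (<⇒≤ (inv-pos 0<δ)) (∣inv∣≤ 0<δ δ≤p) (∣inv∣≤ 0<δ δ≤q)))

Σ<-const : ∀ n c → Σ< n (λ _ → c) ≡ ι n * c
Σ<-const zero    c = sym (*-zeroˡ c)
Σ<-const (suc n) c = trans (cong (_+ c) (Σ<-const n c))
  (solve 2 (λ a c → a :* c :+ c := (con 1ℚ :+ a) :* c) refl (ι n) c)

Σ<-diff : ∀ n {f g : ℕ → ℚ} {c} → (∀ k → k ℕ.< n → ∣ f k - g k ∣ ≤ c) →
          ∣ Σ< n f - Σ< n g ∣ ≤ ι n * c
Σ<-diff zero {c = c} _ = ≤-reflexive (sym (*-zeroˡ c))
Σ<-diff (suc n) {f} {g} {c} close = begin
  ∣ (F + f n) - (G + g n) ∣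
    ≡⟨ cong ∣_∣ (solve 4 (λ F G a b → (F :+ a) :- (G :+ b) := (F :- G) :+ (a :- b)) refl F G (f n) (g n)) ⟩
  ∣ (F - G) + (f n - g n) ∣
    ≤⟨ ∣p+q∣≤∣p∣+∣q∣ (F - G) (f n - g n) ⟩
  ∣ F - G ∣ + ∣ f n - g n ∣
    ≤⟨ +-mono-≤ (Σ<-diff n (λ k k<n → close k (ℕ.m<n⇒m<1+n k<n))) (close n ℕ.≤-refl) ⟩
  ι n * c + c
    ≡⟨ solve 2 (λ a c → a :* c :+ c := (con 1ℚ :+ a) :* c) refl (ι n) c ⟩
  ι (suc n) * c ∎
  where
  open ≤-Reasoning
  F = Σ< n f
  G = Σ< n g

Σ<-+ : ∀ m n f → Σ< (m ℕ.+ n) f ≡ Σ< m f + Σ< n (λ j → f (m ℕ.+ j))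
Σ<-+ m zero    f rewrite ℕ.+-identityʳ m = sym (+-identityʳ (Σ< m f))
Σ<-+ m (suc n) f rewrite ℕ.+-suc m n | Σ<-+ m n f =
  +-assoc (Σ< m f) (Σ< n (λ j → f (m ℕ.+ j))) (f (m ℕ.+ n))

Σ<-blocks : ∀ n m f → Σ< (n ℕ.* m) f ≡ Σ< n (λ k → Σ< m (λ j → f (k ℕ.* m ℕ.+ j)))
Σ<-blocks zero    m f = refl
Σ<-blocks (suc n) m f rewrite ℕ.+-comm m (n ℕ.* m) | Σ<-+ (n ℕ.* m) m f | Σ<-blocks n m f = refl

-- Real numbers are Cauchy sequences of rationals; the order relations below are the usual ones on
-- limits (x < y needs a uniform positive gap), and never depend on finitely many terms.
Cauchy : (ℕ → ℚ) → Set
Cauchy s = ∀ η → 0ℚ < η → ∃ λ N → ∀ m n → N ℕ.≤ m → N ℕ.≤ n → ∣ s m - s n ∣ ≤ η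

record ℝ : Set where
  constructor mkℝ
  field
    seq    : ℕ → ℚ
    cauchy : Cauchy seq
open ℝ public

infix 4 _<ᴿ_ _≤ᴿ_

_<ᴿ_ : ℝ → ℝ → Set
x <ᴿ y = ∃ λ η → 0ℚ < η × ∃ λ N → ∀ n → N ℕ.≤ n → seq x n + η ≤ seq y n

_≤ᴿ_ : ℝ → ℝ → Set
x ≤ᴿ y = ∀ η → 0ℚ < η → ∃ λ N → ∀ n → N ℕ.≤ n → seq x n ≤ seq y n + η

fromℚ : ℚ → ℝ
fromℚ q = mkℝ (λ _ → q) λ η 0<η → 0 , λ _ _ _ _ →
  ≤-trans (≤-reflexive (cong ∣_∣ (+-inverseʳ q))) (<⇒≤ 0<η)

fromℕ : ℕ → ℝ
fromℕ n = fromℚ (ι n)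

0ᴿ 1ᴿ 2ᴿ ½ᴿ : ℝ
0ᴿ = fromℕ 0
1ᴿ = fromℕ 1
2ᴿ = fromℕ 2
½ᴿ = fromℚ ½

-- Criterion: |tₘ − tₙ| ≤ A|xₘ − xₙ| + B|yₘ − yₙ| + D(1/(m+1) + 1/(n+1)) for large m, n.
dominated-cauchy : ∀ x y t A B D → 0ℚ ≤ A → 0ℚ ≤ B → 0ℚ ≤ D → ∀ N₀ →
  (∀ m n → N₀ ℕ.≤ m → N₀ ℕ.≤ n →
    ∣ t m - t n ∣ ≤ A * ∣ seq x m - seq x n ∣ + B * ∣ seq y m - seq y n ∣ + D * (inv (ι (suc m)) + inv (ι (suc n)))) →
  Cauchy t
dominated-cauchy x y t A B D 0≤A 0≤B 0≤D N₀ dom η 0<η =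
  N , λ m n N≤m N≤n → begin
    ∣ t m - t n ∣
      ≤⟨ dom m n (ℕ.≤-trans N₀≤N N≤m) (ℕ.≤-trans N₀≤N N≤n) ⟩
    A * ∣ seq x m - seq x n ∣ + B * ∣ seq y m - seq y n ∣ + D * (inv (ι (suc m)) + inv (ι (suc n)))
      ≤⟨ +-mono-≤ (+-mono-≤
           (*-monoˡ-≤-nonNeg A {{nonNegative 0≤A}}
             (proj₂ (cauchy x d 0<d) m n (ℕ.≤-trans N₁≤N N≤m) (ℕ.≤-trans N₁≤N N≤n)))
           (*-monoˡ-≤-nonNeg B {{nonNegative 0≤B}}
             (proj₂ (cauchy y d 0<d) m n (ℕ.≤-trans N₂≤N N≤m) (ℕ.≤-trans N₂≤N N≤n))))
           (*-monoˡ-≤-nonNeg D {{nonNegative 0≤D}}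
             (+-mono-≤ (small m (ℕ.≤-trans K≤N N≤m)) (small n (ℕ.≤-trans K≤N N≤n)))) ⟩
    A * d + B * d + D * (d + d)
      ≡⟨ solve 4 (λ A B D d → A :* d :+ B :* d :+ D :* (d :+ d) := (A :+ B :+ (D :+ D)) :* d)
           refl A B D d ⟩
    (A + B + (D + D)) * d
      ≤⟨ *-monoʳ-≤-nonNeg d {{nonNegative (<⇒≤ 0<d)}} S≤S+1 ⟩
    S * (η * inv S)
      ≡⟨ solve 3 (λ S η i → S :* (η :* i) := η :* (S :* i)) refl S η (inv S) ⟩
    η * (S * inv S)
      ≡⟨ cong (η *_) (inv-inverseʳ 0<S) ⟩
    η * 1ℚ
      ≡⟨ *-identityʳ η ⟩
    η ∎
  where
  open ≤-Reasoning
  S₀ = A + B + (D + D)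
  S = 1ℚ + S₀
  0<S : 0ℚ < S
  0<S = +-mono-<-≤ 0<1 (+-mono-≤ (+-mono-≤ 0≤A 0≤B) (+-mono-≤ 0≤D 0≤D))
  S≤S+1 : S₀ ≤ S
  S≤S+1 = ≤-trans (≤-reflexive (sym (+-identityˡ S₀))) (+-monoˡ-≤ S₀ (<⇒≤ 0<1))
  d = η * inv S
  0<d : 0ℚ < d
  0<d = *-pos 0<η (inv-pos 0<S)
  N₁ = proj₁ (cauchy x d 0<d)
  N₂ = proj₁ (cauchy y d 0<d)
  K = proj₁ (archimedean (inv d))
  small : ∀ m → K ℕ.≤ m → inv (ι (suc m)) ≤ d
  small m K≤m = ≤-trans (inv-anti (inv-pos 0<d)
      (≤-trans (proj₂ (archimedean (inv d))) (ι-mono (ℕ.m≤n⇒m≤1+n K≤m))))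
    (≤-reflexive inv-inv)
    where
    inv-inv : inv (inv d) ≡ d
    inv-inv = trans (sym (*-identityˡ (inv (inv d))))
      (trans (cong (_* inv (inv d)) (sym (inv-inverseʳ 0<d)))
      (trans (*-assoc d (inv d) (inv (inv d)))
      (trans (cong (d *_) (inv-inverseʳ (inv-pos 0<d))) (*-identityʳ d))))
  N = (N₀ ℕ.⊔ N₁) ℕ.⊔ (N₂ ℕ.⊔ K)
  N₀≤N = ℕ.≤-trans (ℕ.m≤m⊔n N₀ N₁) (ℕ.m≤m⊔n (N₀ ℕ.⊔ N₁) (N₂ ℕ.⊔ K))
  N₁≤N = ℕ.≤-trans (ℕ.m≤n⊔m N₀ N₁) (ℕ.m≤m⊔n (N₀ ℕ.⊔ N₁) (N₂ ℕ.⊔ K))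
  N₂≤N = ℕ.≤-trans (ℕ.m≤m⊔n N₂ K) (ℕ.m≤n⊔m (N₀ ℕ.⊔ N₁) (N₂ ℕ.⊔ K))
  K≤N = ℕ.≤-trans (ℕ.m≤n⊔m N₂ K) (ℕ.m≤n⊔m (N₀ ℕ.⊔ N₁) (N₂ ℕ.⊔ K))

dominated-cauchy₂ : ∀ x y t A B → 0ℚ ≤ A → 0ℚ ≤ B → ∀ N₀ →
  (∀ m n → N₀ ℕ.≤ m → N₀ ℕ.≤ n → ∣ t m - t n ∣ ≤ A * ∣ seq x m - seq x n ∣ + B * ∣ seq y m - seq y n ∣) → Cauchy t
dominated-cauchy₂ x y t A B 0≤A 0≤B N₀ dom =
  dominated-cauchy x y t A B 0ℚ 0≤A 0≤B ≤-refl N₀ λ m n p q →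
    ≤-trans (dom m n p q) (≤-reflexive (sym
      (trans (cong (_+_ (A * ∣ seq x m - seq x n ∣ + B * ∣ seq y m - seq y n ∣))
               (*-zeroˡ (inv (ι (suc m)) + inv (ι (suc n)))))
             (+-identityʳ (A * ∣ seq x m - seq x n ∣ + B * ∣ seq y m - seq y n ∣)))))

eventually-bounded : ∀ x → ∃ λ B → 0ℚ < B × ∃ λ N → ∀ n → N ℕ.≤ n → ∣ seq x n ∣ ≤ B
eventually-bounded x = 1ℚ + ∣ s N ∣ , +-mono-<-≤ 0<1 (0≤∣p∣ (s N)) , N , λ n N≤n → begin
  ∣ s n ∣                    ≡⟨ cong ∣_∣ (solve 2 (λ a b → a := (a :- b) :+ b) refl (s n) (s N)) ⟩
  ∣ (s n - s N) + s N ∣      ≤⟨ ∣p+q∣≤∣p∣+∣q∣ (s n - s N) (s N) ⟩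
  ∣ s n - s N ∣ + ∣ s N ∣    ≤⟨ +-monoˡ-≤ ∣ s N ∣ (proj₂ (cauchy x 1ℚ 0<1) n N N≤n ℕ.≤-refl) ⟩
  1ℚ + ∣ s N ∣               ∎
  where
  open ≤-Reasoning
  N = proj₁ (cauchy x 1ℚ 0<1)
  s = seq x

infixl 6 _+ᴿ_ _-ᴿ_
infixl 7 _*ᴿ_

_+ᴿ_ : ℝ → ℝ → ℝ
x +ᴿ y = mkℝ (λ n → seq x n + seq y n)
  (dominated-cauchy₂ x y (λ n → seq x n + seq y n) 1ℚ 1ℚ (<⇒≤ 0<1) (<⇒≤ 0<1) 0 λ m n _ _ → begin
    ∣ (seq x m + seq y m) - (seq x n + seq y n) ∣
      ≡⟨ cong ∣_∣ (solve 4 (λ a b c d → (a :+ b) :- (c :+ d) := (a :- c) :+ (b :- d)) refl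
           (seq x m) (seq y m) (seq x n) (seq y n)) ⟩
    ∣ (seq x m - seq x n) + (seq y m - seq y n) ∣
      ≤⟨ ∣p+q∣≤∣p∣+∣q∣ (seq x m - seq x n) (seq y m - seq y n) ⟩
    ∣ seq x m - seq x n ∣ + ∣ seq y m - seq y n ∣
      ≡⟨ sym (cong₂ _+_ (*-identityˡ ∣ seq x m - seq x n ∣) (*-identityˡ ∣ seq y m - seq y n ∣)) ⟩
    1ℚ * ∣ seq x m - seq x n ∣ + 1ℚ * ∣ seq y m - seq y n ∣ ∎)
  where open ≤-Reasoning

-ᴿ_ : ℝ → ℝ
-ᴿ x = mkℝ (λ n → - seq x n) λ η 0<η →
  proj₁ (cauchy x η 0<η) , λ m n p q → ≤-trans
    (≤-reflexive (trans
      (cong ∣_∣ (solve 2 (λ a b → (:- a) :- (:- b) := :- (a :- b)) refl (seq x m) (seq x n)))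
      (∣-p∣≡∣p∣ (seq x m - seq x n))))
    (proj₂ (cauchy x η 0<η) m n p q)

_-ᴿ_ : ℝ → ℝ → ℝ
x -ᴿ y = x +ᴿ (-ᴿ y)

*-diff : ∀ a b c d {A B} → ∣ c ∣ ≤ A → ∣ b ∣ ≤ B →
         ∣ a * b - c * d ∣ ≤ B * ∣ a - c ∣ + A * ∣ b - d ∣
*-diff a b c d {A} {B} c≤A b≤B = begin
  ∣ a * b - c * d ∣
    ≡⟨ cong ∣_∣ (solve 4 (λ a b c d → a :* b :- c :* d := b :* (a :- c) :+ c :* (b :- d)) refl a b c d) ⟩
  ∣ b * (a - c) + c * (b - d) ∣
    ≤⟨ ∣p+q∣≤∣p∣+∣q∣ (b * (a - c)) (c * (b - d)) ⟩
  ∣ b * (a - c) ∣ + ∣ c * (b - d) ∣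
    ≡⟨ cong₂ _+_ (∣p*q∣≡∣p∣*∣q∣ b (a - c)) (∣p*q∣≡∣p∣*∣q∣ c (b - d)) ⟩
  ∣ b ∣ * ∣ a - c ∣ + ∣ c ∣ * ∣ b - d ∣
    ≤⟨ +-mono-≤ (*-monoʳ-≤-nonNeg ∣ a - c ∣ {{∣-∣-nonNeg (a - c)}} b≤B)
                (*-monoʳ-≤-nonNeg ∣ b - d ∣ {{∣-∣-nonNeg (b - d)}} c≤A) ⟩
  B * ∣ a - c ∣ + A * ∣ b - d ∣ ∎
  where open ≤-Reasoning

_*ᴿ_ : ℝ → ℝ → ℝ
x *ᴿ y = mkℝ (λ n → seq x n * seq y n) prf
  where
  prf : Cauchy (λ n → seq x n * seq y n)
  prf = let A , 0<A , N₁ , x≤A = eventually-bounded x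
            B , 0<B , N₂ , y≤B = eventually-bounded y in
    dominated-cauchy₂ x y (λ n → seq x n * seq y n) B A (<⇒≤ 0<B) (<⇒≤ 0<A) (N₁ ℕ.⊔ N₂) λ m n p q →
      *-diff (seq x m) (seq y m) (seq x n) (seq y n)
        (x≤A n (ℕ.≤-trans (ℕ.m≤m⊔n N₁ N₂) q)) (y≤B m (ℕ.≤-trans (ℕ.m≤n⊔m N₁ N₂) p))

eventually-≥ : ∀ x → 0ᴿ <ᴿ x → ∃ λ δ → 0ℚ < δ × ∃ λ N → ∀ n → N ℕ.≤ n → δ ≤ seq x n
eventually-≥ x (δ , 0<δ , N , h) = δ , 0<δ , N , λ n p →
  ≤-trans (≤-reflexive (sym (+-identityˡ δ))) (h n p)

recip : (x : ℝ) → 0ᴿ <ᴿ x → ℝ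
recip x 0<x = mkℝ (λ n → inv (seq x n)) prf
  where
  open ≤-Reasoning
  prf : Cauchy (λ n → inv (seq x n))
  prf = let δ , 0<δ , N , x≥δ = eventually-≥ x 0<x in
    dominated-cauchy₂ x x (λ n → inv (seq x n)) (inv δ * inv δ) 0ℚ
      (<⇒≤ (*-pos (inv-pos 0<δ) (inv-pos 0<δ))) ≤-refl N λ m n p q →
      let a = seq x m ; b = seq x n in begin
      ∣ inv a - inv b ∣
        ≡⟨ cong ∣_∣ (inv-diff (<-≤-trans 0<δ (x≥δ m p)) (<-≤-trans 0<δ (x≥δ n q))) ⟩
      ∣ (b - a) * (inv a * inv b) ∣
        ≤⟨ scaled-by-invs (b - a) 0<δ (x≥δ m p) (x≥δ n q) ⟩
      ∣ b - a ∣ * (inv δ * inv δ)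
        ≡⟨ cong (_* (inv δ * inv δ)) (∣-∣-sym b a) ⟩
      ∣ a - b ∣ * (inv δ * inv δ)
        ≡⟨ solve 2 (λ z i → z :* i := i :* z :+ con 0ℚ :* z) refl ∣ a - b ∣ (inv δ * inv δ) ⟩
      inv δ * inv δ * ∣ a - b ∣ + 0ℚ * ∣ a - b ∣ ∎

recip-pos : ∀ x (0<x : 0ᴿ <ᴿ x) → 0ᴿ <ᴿ recip x 0<x
recip-pos x 0<x =
  let δ , 0<δ , N₁ , x≥δ = eventually-≥ x 0<x
      B , 0<B , N₂ , x≤B = eventually-bounded x in
  inv B , inv-pos 0<B , N₁ ℕ.⊔ N₂ , λ n p → ≤-trans (≤-reflexive (+-identityˡ (inv B)))
    (inv-anti (<-≤-trans 0<δ (x≥δ n (ℕ.≤-trans (ℕ.m≤m⊔n N₁ N₂) p)))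
      (≤-trans (p≤∣p∣ (seq x n)) (x≤B n (ℕ.≤-trans (ℕ.m≤n⊔m N₁ N₂) p))))

*ᴿ-pos : ∀ x y → 0ᴿ <ᴿ x → 0ᴿ <ᴿ y → 0ᴿ <ᴿ x *ᴿ y
*ᴿ-pos x y 0<x 0<y =
  let a , 0<a , N₁ , x≥a = eventually-≥ x 0<x
      b , 0<b , N₂ , y≥b = eventually-≥ y 0<y in
  a * b , *-pos 0<a 0<b , N₁ ℕ.⊔ N₂ , λ n p → ≤-trans (≤-reflexive (+-identityˡ (a * b)))
    (let y≥b' = y≥b n (ℕ.≤-trans (ℕ.m≤n⊔m N₁ N₂) p) in
     *-mono (<⇒≤ 0<a) (≤-trans (<⇒≤ 0<b) y≥b') (x≥a n (ℕ.≤-trans (ℕ.m≤m⊔n N₁ N₂) p)) y≥b')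

-- Left-endpoint Riemann sum of dt/t from 1 to q with N cells of equal (signed) length.
riemann : ℕ → ℚ → ℚ
riemann N q = Σ< N (λ k → h * inv (1ℚ + ι k * h))
  where h = (q - 1ℚ) * inv (ι N)

module _ {δ : ℚ} (0<δ : 0ℚ < δ) (δ≤1 : δ ≤ 1ℚ) where

  nodes-≥ : ∀ N q → δ ≤ q → ∀ k → k ℕ.≤ suc N → δ ≤ 1ℚ + ι k * ((q - 1ℚ) * inv (ι (suc N)))
  nodes-≥ N q δ≤q k k≤N = begin
    δ ≡⟨ solve 2 (λ δ θ → δ := (con 1ℚ :- θ) :* δ :+ θ :* δ) refl δ θ ⟩
    (1ℚ - θ) * δ + θ * δ
      ≤⟨ +-mono-≤ (*-monoˡ-≤-nonNeg (1ℚ - θ) {{nonNegative 0≤1-θ}} δ≤1)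
                  (*-monoˡ-≤-nonNeg θ {{nonNegative 0≤θ}} δ≤q) ⟩
    (1ℚ - θ) * 1ℚ + θ * q
      ≡⟨ solve 3 (λ k i q → (con 1ℚ :- k :* i) :* con 1ℚ :+ k :* i :* q :=
                             con 1ℚ :+ k :* ((q :- con 1ℚ) :* i)) refl (ι k) i q ⟩
    1ℚ + ι k * ((q - 1ℚ) * i) ∎
    where
    open ≤-Reasoning
    i = inv (ι (suc N))
    θ = ι k * i
    0≤i = <⇒≤ (inv-pos (0<ι N))
    0≤θ : 0ℚ ≤ θ
    0≤θ = *-nonNeg (0≤ι k) 0≤i
    θ≤1 : θ ≤ 1ℚ
    θ≤1 = ≤-trans (*-monoʳ-≤-nonNeg i {{nonNegative 0≤i}} (ι-mono k≤N))
                  (≤-reflexive (inv-inverseʳ (0<ι N)))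
    0≤1-θ : 0ℚ ≤ 1ℚ - θ
    0≤1-θ = ≤-trans (≤-reflexive (sym (+-inverseʳ θ))) (+-monoˡ-≤ (- θ) θ≤1)

  riemann-lipschitz : ∀ N q q' → δ ≤ q → δ ≤ q' →
    ∣ riemann (suc N) q - riemann (suc N) q' ∣ ≤ ∣ q - q' ∣ * (inv δ * inv δ)
  riemann-lipschitz N q q' δ≤q δ≤q' = ≤-trans
    (Σ<-diff (suc N) λ k k<N →
      let p≥δ = nodes-≥ N q δ≤q k (ℕ.<⇒≤ k<N) ; p'≥δ = nodes-≥ N q' δ≤q' k (ℕ.<⇒≤ k<N) in
      ≤-trans (≤-reflexive (cong ∣_∣ (quotient-diff h h' (ι k) refl refl
          (<-≤-trans 0<δ p≥δ) (<-≤-trans 0<δ p'≥δ))))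
        (scaled-by-invs (h - h') 0<δ p≥δ p'≥δ))
    (≤-reflexive (begin
      ι (suc N) * (∣ h - h' ∣ * D)
        ≡⟨ cong (λ z → ι (suc N) * (∣ z ∣ * D))
             (solve 3 (λ q q' i → (q :- con 1ℚ) :* i :- (q' :- con 1ℚ) :* i := (q :- q') :* i) refl q q' i) ⟩
      ι (suc N) * (∣ (q - q') * i ∣ * D)
        ≡⟨ cong (λ z → ι (suc N) * (z * D)) (trans (∣p*q∣≡∣p∣*∣q∣ (q - q') i)
             (cong (∣ q - q' ∣ *_) (0≤p⇒∣p∣≡p (<⇒≤ (inv-pos (0<ι N)))))) ⟩
      ι (suc N) * (∣ q - q' ∣ * i * D)
        ≡⟨ solve 4 (λ n z i D → n :* (z :* i :* D) := (n :* i) :* (z :* D)) refl (ι (suc N)) ∣ q - q' ∣ i D ⟩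
      (ι (suc N) * i) * (∣ q - q' ∣ * D)
        ≡⟨ cong (_* (∣ q - q' ∣ * D)) (inv-inverseʳ (0<ι N)) ⟩
      1ℚ * (∣ q - q' ∣ * D)
        ≡⟨ *-identityˡ (∣ q - q' ∣ * D) ⟩
      ∣ q - q' ∣ * D ∎))
    where
    open ≡-Reasoning
    i = inv (ι (suc N))
    D = inv δ * inv δ
    h = (q - 1ℚ) * i
    h' = (q' - 1ℚ) * i

  riemann-refine : ∀ N M q → δ ≤ q →
    ∣ riemann (suc N ℕ.* suc M) q - riemann (suc N) q ∣ ≤
      ∣ q - 1ℚ ∣ * ∣ q - 1ℚ ∣ * (inv δ * inv δ) * inv (ι (suc N))
  riemann-refine N M q δ≤q = begin
    ∣ Σ< (suc N ℕ.* suc M) F - Σ< (suc N) G ∣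
      ≡⟨ cong (λ z → ∣ z - Σ< (suc N) G ∣) (Σ<-blocks (suc N) (suc M) F) ⟩
    ∣ Σ< (suc N) (λ k → Σ< (suc M) (λ j → F (k ℕ.* suc M ℕ.+ j))) - Σ< (suc N) G ∣
      ≤⟨ Σ<-diff (suc N) block ⟩
    ι (suc N) * (ι (suc M) * (∣ g ∣ * (ι (suc M) * ∣ g ∣ * D)))
      ≡⟨ solve 4 (λ n m g D → n :* (m :* (g :* (m :* g :* D))) := (n :* (m :* g)) :* (m :* g) :* D)
           refl (ι (suc N)) (ι (suc M)) ∣ g ∣ D ⟩
    (ι (suc N) * (ι (suc M) * ∣ g ∣)) * (ι (suc M) * ∣ g ∣) * D
      ≡⟨ cong (λ z → (ι (suc N) * z) * z * D) m∣g∣≡ ⟩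
    (ι (suc N) * (∣ q - 1ℚ ∣ * i)) * (∣ q - 1ℚ ∣ * i) * D
      ≡⟨ solve 4 (λ n z i D → (n :* (z :* i)) :* (z :* i) :* D := (n :* i) :* (z :* z :* D :* i))
           refl (ι (suc N)) ∣ q - 1ℚ ∣ i D ⟩
    (ι (suc N) * i) * (∣ q - 1ℚ ∣ * ∣ q - 1ℚ ∣ * D * i)
      ≡⟨ cong (_* (∣ q - 1ℚ ∣ * ∣ q - 1ℚ ∣ * D * i)) (inv-inverseʳ (0<ι N)) ⟩
    1ℚ * (∣ q - 1ℚ ∣ * ∣ q - 1ℚ ∣ * D * i)
      ≡⟨ *-identityˡ (∣ q - 1ℚ ∣ * ∣ q - 1ℚ ∣ * D * i) ⟩
    ∣ q - 1ℚ ∣ * ∣ q - 1ℚ ∣ * D * i ∎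
    where
    open ≤-Reasoning
    P = M ℕ.+ N ℕ.* suc M
    i = inv (ι (suc N))
    D = inv δ * inv δ
    g = (q - 1ℚ) * inv (ι (suc P))
    h = (q - 1ℚ) * i
    F G : ℕ → ℚ
    F k = g * inv (1ℚ + ι k * g)
    G k = h * inv (1ℚ + ι k * h)
    h≡mg : h ≡ ι (suc M) * g
    h≡mg = begin-equality
      (q - 1ℚ) * i
        ≡⟨ sym (*-identityʳ ((q - 1ℚ) * i)) ⟩
      (q - 1ℚ) * i * 1ℚ
        ≡⟨ cong ((q - 1ℚ) * i *_) (sym (trans (cong (_* j) (sym (ι-* (suc N) (suc M)))) (inv-inverseʳ (0<ι P)))) ⟩
      (q - 1ℚ) * i * (ι (suc N) * ι (suc M) * j)
        ≡⟨ solve 5 (λ z i n m j → z :* i :* (n :* m :* j) := (n :* i) :* (m :* (z :* j))) refl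
             (q - 1ℚ) i (ι (suc N)) (ι (suc M)) j ⟩
      (ι (suc N) * i) * (ι (suc M) * ((q - 1ℚ) * j))
        ≡⟨ cong (_* (ι (suc M) * ((q - 1ℚ) * j))) (inv-inverseʳ (0<ι N)) ⟩
      1ℚ * (ι (suc M) * g)
        ≡⟨ *-identityˡ (ι (suc M) * g) ⟩
      ι (suc M) * g ∎
      where j = inv (ι (suc P))
    m∣g∣≡ : ι (suc M) * ∣ g ∣ ≡ ∣ q - 1ℚ ∣ * i
    m∣g∣≡ = begin-equality
      ι (suc M) * ∣ g ∣      ≡⟨ cong (_* ∣ g ∣) (sym (0≤p⇒∣p∣≡p (0≤ι (suc M)))) ⟩
      ∣ ι (suc M) ∣ * ∣ g ∣  ≡⟨ sym (∣p*q∣≡∣p∣*∣q∣ (ι (suc M)) g) ⟩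
      ∣ ι (suc M) * g ∣      ≡⟨ cong ∣_∣ (sym h≡mg) ⟩
      ∣ (q - 1ℚ) * i ∣       ≡⟨ ∣p*q∣≡∣p∣*∣q∣ (q - 1ℚ) i ⟩
      ∣ q - 1ℚ ∣ * ∣ i ∣     ≡⟨ cong (∣ q - 1ℚ ∣ *_) (0≤p⇒∣p∣≡p (<⇒≤ (inv-pos (0<ι N)))) ⟩
      ∣ q - 1ℚ ∣ * i         ∎
    block : ∀ k → k ℕ.< suc N →
      ∣ Σ< (suc M) (λ j → F (k ℕ.* suc M ℕ.+ j)) - G k ∣ ≤ ι (suc M) * (∣ g ∣ * (ι (suc M) * ∣ g ∣ * D))
    block k k<N = ≤-trans (≤-reflexive (cong (λ z → ∣ Σ< (suc M) (λ j → F (k ℕ.* suc M ℕ.+ j)) - z ∣) G≡))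
      (Σ<-diff (suc M) cell)
      where
      c = k ℕ.* suc M
      node : ℕ → ℚ
      node j = 1ℚ + ι j * g
      G≡ : G k ≡ Σ< (suc M) (λ _ → F c)
      G≡ = begin-equality
        h * inv (1ℚ + ι k * h)
          ≡⟨ cong (λ z → z * inv (1ℚ + ι k * z)) h≡mg ⟩
        ι (suc M) * g * inv (1ℚ + ι k * (ι (suc M) * g))
          ≡⟨ cong (λ z → ι (suc M) * g * inv (1ℚ + z)) (trans (sym (*-assoc (ι k) (ι (suc M)) g))
               (cong (_* g) (sym (ι-* k (suc M))))) ⟩
        ι (suc M) * g * inv (1ℚ + ι c * g)
          ≡⟨ *-assoc (ι (suc M)) g (inv (1ℚ + ι c * g)) ⟩
        ι (suc M) * F c
          ≡⟨ sym (Σ<-const (suc M) (F c)) ⟩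
        Σ< (suc M) (λ _ → F c) ∎
      c+j≤ : ∀ j → j ℕ.< suc M → c ℕ.+ j ℕ.≤ suc P
      c+j≤ j j<M = ℕ.≤-trans (ℕ.+-monoʳ-≤ c (ℕ.<⇒≤ j<M))
        (ℕ.≤-trans (ℕ.≤-reflexive (ℕ.+-comm c (suc M))) (ℕ.*-monoˡ-≤ (suc M) k<N))
      cell : ∀ j → j ℕ.< suc M → ∣ F (c ℕ.+ j) - F c ∣ ≤ ∣ g ∣ * (ι (suc M) * ∣ g ∣ * D)
      cell j j<M = begin
        ∣ g * inv a - g * inv b ∣
          ≡⟨ cong ∣_∣ (solve 3 (λ g x y → g :* x :- g :* y := g :* (x :- y)) refl g (inv a) (inv b)) ⟩
        ∣ g * (inv a - inv b) ∣
          ≡⟨ ∣p*q∣≡∣p∣*∣q∣ g (inv a - inv b) ⟩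
        ∣ g ∣ * ∣ inv a - inv b ∣
          ≤⟨ *-monoˡ-≤-nonNeg ∣ g ∣ {{∣-∣-nonNeg g}} (begin
            ∣ inv a - inv b ∣
              ≡⟨ cong ∣_∣ (inv-diff (<-≤-trans 0<δ a≥δ) (<-≤-trans 0<δ b≥δ)) ⟩
            ∣ (b - a) * (inv a * inv b) ∣
              ≤⟨ scaled-by-invs (b - a) 0<δ a≥δ b≥δ ⟩
            ∣ b - a ∣ * D
              ≤⟨ *-monoʳ-≤-nonNeg D {{nonNegative 0≤D}} (begin
                ∣ b - a ∣
                  ≡⟨ ∣-∣-sym b a ⟩
                ∣ a - b ∣
                  ≡⟨ cong (λ z → ∣ (1ℚ + z * g) - b ∣) (ι-+ c j) ⟩
                ∣ (1ℚ + (ι c + ι j) * g) - b ∣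
                  ≡⟨ cong ∣_∣ (solve 3 (λ c j g → (con 1ℚ :+ (c :+ j) :* g) :- (con 1ℚ :+ c :* g) := j :* g)
                       refl (ι c) (ι j) g) ⟩
                ∣ ι j * g ∣
                  ≡⟨ trans (∣p*q∣≡∣p∣*∣q∣ (ι j) g) (cong (_* ∣ g ∣) (0≤p⇒∣p∣≡p (0≤ι j))) ⟩
                ι j * ∣ g ∣
                  ≤⟨ *-monoʳ-≤-nonNeg ∣ g ∣ {{∣-∣-nonNeg g}} (ι-mono (ℕ.<⇒≤ j<M)) ⟩
                ι (suc M) * ∣ g ∣ ∎) ⟩
            ι (suc M) * ∣ g ∣ * D ∎) ⟩
        ∣ g ∣ * (ι (suc M) * ∣ g ∣ * D) ∎
        where
        a = node (c ℕ.+ j)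
        b = node c
        0≤D = <⇒≤ (*-pos (inv-pos 0<δ) (inv-pos 0<δ))
        a≥δ : δ ≤ a
        a≥δ = nodes-≥ P q δ≤q (c ℕ.+ j) (c+j≤ j j<M)
        b≥δ : δ ≤ b
        b≥δ = nodes-≥ P q δ≤q c (ℕ.≤-trans (ℕ.m≤m+n c j) (c+j≤ j j<M))

  riemann-close : ∀ N M q → δ ≤ q →
    ∣ riemann (suc N) q - riemann (suc M) q ∣ ≤
      ∣ q - 1ℚ ∣ * ∣ q - 1ℚ ∣ * (inv δ * inv δ) * (inv (ι (suc N)) + inv (ι (suc M)))
  riemann-close N M q δ≤q = begin
    ∣ riemann (suc N) q - riemann (suc M) q ∣
      ≤⟨ ∣-∣-triangle (riemann (suc N) q) (riemann (suc N ℕ.* suc M) q) (riemann (suc M) q) ⟩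
    ∣ riemann (suc N) q - riemann (suc N ℕ.* suc M) q ∣ +
    ∣ riemann (suc N ℕ.* suc M) q - riemann (suc M) q ∣
      ≡⟨ cong₂ _+_ (∣-∣-sym (riemann (suc N) q) (riemann (suc N ℕ.* suc M) q))
           (cong (λ z → ∣ riemann z q - riemann (suc M) q ∣) (ℕ.*-comm (suc N) (suc M))) ⟩
    ∣ riemann (suc N ℕ.* suc M) q - riemann (suc N) q ∣ +
    ∣ riemann (suc M ℕ.* suc N) q - riemann (suc M) q ∣
      ≤⟨ +-mono-≤ (riemann-refine N M q δ≤q) (riemann-refine M N q δ≤q) ⟩
    E * inv (ι (suc N)) + E * inv (ι (suc M))
      ≡⟨ sym (*-distribˡ-+ E (inv (ι (suc N))) (inv (ι (suc M)))) ⟩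
    E * (inv (ι (suc N)) + inv (ι (suc M))) ∎
    where
    open ≤-Reasoning
    E = ∣ q - 1ℚ ∣ * ∣ q - 1ℚ ∣ * (inv δ * inv δ)

riemann-diff : ∀ {δ₀} → 0ℚ < δ₀ → ∃ λ D → 0ℚ < D × (∀ m n a b B → δ₀ ≤ a → δ₀ ≤ b → 0ℚ < B →
  ∣ b - 1ℚ ∣ ≤ B → ∣ riemann (suc m) a - riemann (suc n) b ∣ ≤
    D * ∣ a - b ∣ + 0ℚ * ∣ a - b ∣ + B * B * D * (inv (ι (suc m)) + inv (ι (suc n))))
riemann-diff {δ₀} 0<δ₀ = D , 0<D , bound
  where
  open ≤-Reasoning
  δ = δ₀ ⊓ 1ℚ
  0<δ : 0ℚ < δ
  0<δ with ⊓-sel δ₀ 1ℚ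
  ... | inj₁ eq = subst (0ℚ <_) (sym eq) 0<δ₀
  ... | inj₂ eq = subst (0ℚ <_) (sym eq) 0<1
  δ≤1 : δ ≤ 1ℚ
  δ≤1 = p⊓q≤q δ₀ 1ℚ
  D = inv δ * inv δ
  0<D : 0ℚ < D
  0<D = *-pos (inv-pos 0<δ) (inv-pos 0<δ)
  bound : ∀ m n a b B → δ₀ ≤ a → δ₀ ≤ b → 0ℚ < B → ∣ b - 1ℚ ∣ ≤ B →
    ∣ riemann (suc m) a - riemann (suc n) b ∣ ≤
      D * ∣ a - b ∣ + 0ℚ * ∣ a - b ∣ + B * B * D * (inv (ι (suc m)) + inv (ι (suc n)))
  bound m n a b B δ₀≤a δ₀≤b 0<B b≤B = begin
    ∣ riemann (suc m) a - riemann (suc n) b ∣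
      ≤⟨ ∣-∣-triangle (riemann (suc m) a) (riemann (suc m) b) (riemann (suc n) b) ⟩
    ∣ riemann (suc m) a - riemann (suc m) b ∣ + ∣ riemann (suc m) b - riemann (suc n) b ∣
      ≤⟨ +-mono-≤ (riemann-lipschitz 0<δ δ≤1 m a b (≤-trans δ≤δ₀ δ₀≤a) (≤-trans δ≤δ₀ δ₀≤b))
                  (riemann-close 0<δ δ≤1 m n b (≤-trans δ≤δ₀ δ₀≤b)) ⟩
    ∣ a - b ∣ * D + ∣ b - 1ℚ ∣ * ∣ b - 1ℚ ∣ * D * u
      ≤⟨ +-monoʳ-≤ (∣ a - b ∣ * D) (*-monoʳ-≤-nonNeg u {{nonNegative 0≤u}}
           (*-monoʳ-≤-nonNeg D {{nonNegative (<⇒≤ 0<D)}}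
             (*-mono (0≤∣p∣ (b - 1ℚ)) (<⇒≤ 0<B) b≤B b≤B))) ⟩
    ∣ a - b ∣ * D + B * B * D * u
      ≡⟨ solve 3 (λ z D w → z :* D :+ w := D :* z :+ con 0ℚ :* z :+ w) refl ∣ a - b ∣ D (B * B * D * u) ⟩
    D * ∣ a - b ∣ + 0ℚ * ∣ a - b ∣ + B * B * D * u ∎
    where
    u = inv (ι (suc m)) + inv (ι (suc n))
    0≤u : 0ℚ ≤ u
    0≤u = +-mono-≤ (<⇒≤ (inv-pos (0<ι m))) (<⇒≤ (inv-pos (0<ι n)))
    δ≤δ₀ : δ ≤ δ₀
    δ≤δ₀ = p⊓q≤p δ₀ 1ℚ

-- log x = ∫₁ˣ dt/t, as the limit of Riemann sums; the n-th term uses the n-th approximation of x.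
log : (x : ℝ) → 0ᴿ <ᴿ x → ℝ
log x 0<x = mkℝ (λ n → riemann (suc n) (seq x n)) prf
  where
  prf : Cauchy (λ n → riemann (suc n) (seq x n))
  prf = let δ , 0<δ , N₁ , x≥δ = eventually-≥ x 0<x
            B , 0<B , N₂ , x-1≤B = eventually-bounded (x -ᴿ 1ᴿ)
            D , 0<D , bound = riemann-diff 0<δ in
    dominated-cauchy x x (λ n → riemann (suc n) (seq x n)) D 0ℚ (B * B * D)
      (<⇒≤ 0<D) ≤-refl (<⇒≤ (*-pos (*-pos 0<B 0<B) 0<D)) (N₁ ℕ.⊔ N₂) λ m n p q →
      bound m n (seq x m) (seq x n) B
        (x≥δ m (ℕ.≤-trans (ℕ.m≤m⊔n N₁ N₂) p)) (x≥δ n (ℕ.≤-trans (ℕ.m≤m⊔n N₁ N₂) q))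
        0<B (x-1≤B n (ℕ.≤-trans (ℕ.m≤n⊔m N₁ N₂) q))

odds-pos : ∀ ε (0<ε : 0ᴿ <ᴿ ε) → ε <ᴿ ½ᴿ → 0ᴿ <ᴿ (1ᴿ -ᴿ ε) *ᴿ recip ε 0<ε
odds-pos ε 0<ε (η , 0<η , N , ε<½) = *ᴿ-pos (1ᴿ -ᴿ ε) (recip ε 0<ε)
  (η , 0<η , N , λ n p → let e = seq ε n in begin
    0ℚ + η              ≡⟨ solve 2 (λ e η → con 0ℚ :+ η := (e :+ η) :- e) refl e η ⟩
    (e + η) - e         ≤⟨ +-monoˡ-≤ (- e) (ε<½ n p) ⟩
    ½ - e               ≤⟨ +-monoˡ-≤ (- e) (<⇒≤ ½<1) ⟩
    ι 1 - e             ∎)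
  (recip-pos ε 0<ε)
  where
  open ≤-Reasoning
  ½<1 : ½ < ι 1
  ½<1 = *<* (ℤ.+<+ (ℕ.s≤s (ℕ.s≤s ℕ.z≤n)))

-- A Boolean adjacency matrix excludes parallel arcs and allows opposite ones.
record Digraph (n : ℕ) : Set where
  field
    arc      : Fin n → Fin n → Bool
    loopless : ∀ v → arc v v ≡ false

  N⁺ : Fin n → Subset n
  N⁺ v = tabulate (arc v)

  outdeg : Fin n → ℕ
  outdeg v = card (N⁺ v)

open Digraph public

MinOutdegree≥ : ∀ {n} → Digraph n → ℝ → Set
MinOutdegree≥ G t = ∀ v → t ≤ᴿ fromℕ (outdeg G v)

Stable : ∀ {n} → Digraph n → Subset n → Set
Stable G T = ∀ v → v ∈ T → 2 ℕ.* card (N⁺ G v ∩ T) ℕ.≤ outdeg G v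

{-# OPTIONS --safe #-}
-- Work with a rational e approximating ε. Put every vertex into X independently with probability
-- p = (1 − e)/2 and keep those v ∈ X with at most half of their d out-neighbours in X; since X only
-- shrinks, the kept set is stable. Exponential Markov with base 1 + e gives
--   P(2|N⁺(v) ∩ X| > d) ≤ (p(1 + e) + (1 − p)/(1 + e))^d = (1 − e²/2)^d ≤ e/(1 − e),
-- so v is kept with probability at least p(1 − e/(1 − e)) = ½ − e. The degree hypothesis has a factor
-- 2 − e > 1 to spare, which absorbs all errors of approximation. The stable set of maximum size
-- works for every e at once, hence for ε.
module Submission where

open import Defs
open import Data.Nat using (ℕ)
open import Data.Fin.Subset using (Subset; ∣_∣)
open import Data.Product using (∃; _×_)

open import Algebra.Bundles using (CommutativeRing)
import Algebra.Properties.CommutativeMonoid.Sum as Sum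
import Algebra.Properties.CommutativeSemiring.Exp as Exp
open import Data.Bool using (Bool; true; false; _∧_) renaming (T to 𝕋)
open import Data.Fin using (Fin; zero; suc)
import Data.Fin.Properties as Fin
open import Data.Fin.Subset using (_∈_; _∩_; _⊆_; inside; outside; ⊥)
open import Data.Fin.Subset.Properties using (_∈?_; ∉⊥; ∣p∣≤n; anySubset?; p⊆q⇒∣p∣≤∣q∣; x∈p∩q⁺; x∈p∩q⁻)
open import Data.Integer using (+≤+)
import Data.Nat as ℕ
open import Data.Nat using (zero; suc)
import Data.Nat.Properties as ℕ
open import Data.Product using (_,_; proj₁; proj₂)
open import Data.Rational hiding (∣_∣)
open import Data.Rational.Properties
open import Data.Rational.Solver using (module +-*-Solver)
open import Data.Sum using (inj₁; inj₂)
open import Data.Vec using ([]; _∷_; lookup; tabulate; _[_]≔_)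
open import Data.Vec.Properties using ([]=⇒lookup; lookup⇒[]=; lookup∘tabulate)
open import Relation.Binary.PropositionalEquality
open import Relation.Nullary using (yes; no; contradiction; _×-dec_; _→-dec_)
open import Relation.Unary using (Decidable)

open Sum +-0-commutativeMonoid using (sum)
open Exp (CommutativeRing.commutativeSemiring +-*-commutativeRing) using (_^_; ^-homo-*; ^-assocʳ; ^-distrib-*)
open +-*-Solver using (solve; _:=_; _:+_; _:*_; _:-_; :-_; con)

-- Rational arithmetic

-- Most inequalities below are proved in this form: a visibly non-negative difference `c` is
-- supplied and the remaining identity is left to the ring solver.
≤-by-diff : ∀ {a b} c → 0ℚ ≤ c → b ≡ a + c → a ≤ b
≤-by-diff {a} c 0≤c refl = ≤-trans (≤-reflexive (sym (+-identityʳ a))) (+-monoʳ-≤ a 0≤c)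

p≤q⇒0≤q-p : ∀ {p q} → p ≤ q → 0ℚ ≤ q - p
p≤q⇒0≤q-p {p} p≤q = ≤-trans (≤-reflexive (sym (+-inverseʳ p))) (+-monoˡ-≤ (- p) p≤q)

*-monoʳ : ∀ {a b} c → 0ℚ ≤ c → a ≤ b → a * c ≤ b * c
*-monoʳ c 0≤c = *-monoʳ-≤-nonNeg c {{nonNegative 0≤c}}

*-monoˡ : ∀ {a b} c → 0ℚ ≤ c → a ≤ b → c * a ≤ c * b
*-monoˡ c 0≤c = *-monoˡ-≤-nonNeg c {{nonNegative 0≤c}}

0≤1 : 0ℚ ≤ 1ℚ
0≤1 = <⇒≤ 0<1

½≤1 : ½ ≤ 1ℚ
½≤1 = *≤* (+≤+ (ℕ.s≤s ℕ.z≤n))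

^-nonNeg : ∀ {x} → 0ℚ ≤ x → ∀ n → 0ℚ ≤ x ^ n
^-nonNeg 0≤x zero    = 0≤1
^-nonNeg 0≤x (suc n) = *-nonNeg 0≤x (^-nonNeg 0≤x n)

^-≤1 : ∀ {x} → 0ℚ ≤ x → x ≤ 1ℚ → ∀ n → x ^ n ≤ 1ℚ
^-≤1 0≤x x≤1 zero    = ≤-refl
^-≤1 0≤x x≤1 (suc n) = *-mono 0≤x 0≤1 x≤1 (^-≤1 0≤x x≤1 n)

^-≥1 : ∀ {x} → 1ℚ ≤ x → ∀ n → 1ℚ ≤ x ^ n
^-≥1 1≤x zero    = ≤-refl
^-≥1 1≤x (suc n) = *-mono 0≤1 (≤-trans 0≤1 (^-≥1 1≤x n)) 1≤x (^-≥1 1≤x n)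

1^n≡1 : ∀ n → 1ℚ ^ n ≡ 1ℚ
1^n≡1 zero    = refl
1^n≡1 (suc n) = trans (*-identityˡ (1ℚ ^ n)) (1^n≡1 n)

^-inverse : ∀ {x y} → x * y ≡ 1ℚ → ∀ n → x ^ n * y ^ n ≡ 1ℚ
^-inverse {x} {y} xy≡1 n = trans (sym (^-distrib-* x y n)) (trans (cong (_^ n) xy≡1) (1^n≡1 n))

sum-mono : ∀ {n} {f g : Fin n → ℚ} → (∀ i → f i ≤ g i) → sum f ≤ sum g
sum-mono {zero}  f≤g = ≤-refl
sum-mono {suc n} f≤g = +-mono-≤ (f≤g zero) (sum-mono (λ i → f≤g (suc i)))

sum-const : ∀ n c → sum {n} (λ _ → c) ≡ c * ι n
sum-const zero    c = sym (*-zeroʳ c)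
sum-const (suc n) c = trans (cong (c +_) (sum-const n c))
  (solve 2 (λ c m → c :+ c :* m := c :* (con 1ℚ :+ m)) refl c (ι n))

Σ<-lower : ∀ n {f : ℕ → ℚ} {c} → (∀ k → k ℕ.< n → c ≤ f k) → ι n * c ≤ Σ< n f
Σ<-lower zero    {c = c} c≤f = ≤-reflexive (*-zeroˡ c)
Σ<-lower (suc n) {c = c} c≤f = ≤-trans
  (≤-reflexive (solve 2 (λ a c → (con 1ℚ :+ a) :* c := a :* c :+ c) refl (ι n) c))
  (+-mono-≤ (Σ<-lower n (λ k k<n → c≤f k (ℕ.m<n⇒m<1+n k<n))) (c≤f n ℕ.≤-refl))

Σ<-nonNeg : ∀ n {f : ℕ → ℚ} → (∀ k → 0ℚ ≤ f k) → 0ℚ ≤ Σ< n f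
Σ<-nonNeg zero    0≤f = ≤-refl
Σ<-nonNeg (suc n) 0≤f = +-mono-≤ (Σ<-nonNeg n 0≤f) (0≤f n)

-- Expectation over a random subset

indicator : Bool → ℚ
indicator true  = 1ℚ
indicator false = 0ℚ

ι∣tabulate∣ : ∀ {n} (f : Fin n → Bool) → ι ∣ tabulate f ∣ ≡ sum (λ v → indicator (f v))
ι∣tabulate∣ {zero}  f = refl
ι∣tabulate∣ {suc n} f with f zero
... | true  = cong (1ℚ +_) (ι∣tabulate∣ (λ v → f (suc v)))
... | false = trans (ι∣tabulate∣ (λ v → f (suc v))) (sym (+-identityˡ _))

module Expectation (p : ℚ) (0≤p : 0ℚ ≤ p) (p≤1 : p ≤ 1ℚ) where

  0≤1-p : 0ℚ ≤ 1ℚ - p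
  0≤1-p = p≤q⇒0≤q-p p≤1

  average : ∀ c → p * c + (1ℚ - p) * c ≡ c
  average = solve 2 (λ p c → p :* c :+ (con 1ℚ :- p) :* c := c) refl p

  -- Expectation under the product measure with density `p`, computed by conditioning on one element
  -- after another, so that each property of it is an induction on `n`.
  𝔼 : ∀ {n} → (Subset n → ℚ) → ℚ
  𝔼 {zero}  f = f []
  𝔼 {suc n} f = p * 𝔼 (λ X → f (inside ∷ X)) + (1ℚ - p) * 𝔼 (λ X → f (outside ∷ X))

  𝔼-cong : ∀ {n} {f g : Subset n → ℚ} → (∀ X → f X ≡ g X) → 𝔼 f ≡ 𝔼 g
  𝔼-cong {zero}  f≡g = f≡g []
  𝔼-cong {suc n} f≡g = cong₂ (λ a b → p * a + (1ℚ - p) * b)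
    (𝔼-cong (λ X → f≡g (inside ∷ X))) (𝔼-cong (λ X → f≡g (outside ∷ X)))

  𝔼-mono : ∀ {n} {f g : Subset n → ℚ} → (∀ X → f X ≤ g X) → 𝔼 f ≤ 𝔼 g
  𝔼-mono {zero}  f≤g = f≤g []
  𝔼-mono {suc n} f≤g = +-mono-≤
    (*-monoˡ p 0≤p (𝔼-mono (λ X → f≤g (inside ∷ X))))
    (*-monoˡ (1ℚ - p) 0≤1-p (𝔼-mono (λ X → f≤g (outside ∷ X))))

  𝔼-const : ∀ n c → 𝔼 {n} (λ _ → c) ≡ c
  𝔼-const zero    c = refl
  𝔼-const (suc n) c = trans (cong (λ a → p * a + (1ℚ - p) * a) (𝔼-const n c)) (average c)

  𝔼-+ : ∀ {n} (f g : Subset n → ℚ) → 𝔼 (λ X → f X + g X) ≡ 𝔼 f + 𝔼 g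
  𝔼-+ {zero}  f g = refl
  𝔼-+ {suc n} f g = trans (cong₂ (λ a b → p * a + (1ℚ - p) * b) (𝔼-+ f₁ g₁) (𝔼-+ f₀ g₀))
    (solve 5 (λ p a b c d → p :* (a :+ b) :+ (con 1ℚ :- p) :* (c :+ d) :=
        (p :* a :+ (con 1ℚ :- p) :* c) :+ (p :* b :+ (con 1ℚ :- p) :* d))
      refl p (𝔼 f₁) (𝔼 g₁) (𝔼 f₀) (𝔼 g₀))
    where
    f₁ f₀ g₁ g₀ : Subset n → ℚ
    f₁ X = f (inside ∷ X)
    f₀ X = f (outside ∷ X)
    g₁ X = g (inside ∷ X)
    g₀ X = g (outside ∷ X)

  𝔼-* : ∀ {n} c (f : Subset n → ℚ) → 𝔼 (λ X → c * f X) ≡ c * 𝔼 f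
  𝔼-* {zero}  c f = refl
  𝔼-* {suc n} c f = trans (cong₂ (λ a b → p * a + (1ℚ - p) * b) (𝔼-* c f₁) (𝔼-* c f₀))
    (solve 4 (λ p c a b → p :* (c :* a) :+ (con 1ℚ :- p) :* (c :* b) :=
        c :* (p :* a :+ (con 1ℚ :- p) :* b)) refl p c (𝔼 f₁) (𝔼 f₀))
    where
    f₁ f₀ : Subset n → ℚ
    f₁ X = f (inside ∷ X)
    f₀ X = f (outside ∷ X)

  𝔼-sum : ∀ {n} m (f : Fin m → Subset n → ℚ) → 𝔼 (λ X → sum (λ v → f v X)) ≡ sum (λ v → 𝔼 (f v))
  𝔼-sum {n} zero f = 𝔼-const n 0ℚ
  𝔼-sum (suc m) f = trans (𝔼-+ (f zero) (λ X → sum (λ v → f (suc v) X)))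
    (cong (𝔼 (f zero) +_) (𝔼-sum m (λ v → f (suc v))))

  -- Method of conditional expectations: at each element, the branch with the larger conditional
  -- expectation is at least the weighted average of the two.
  𝔼-attained : ∀ {n} (f : Subset n → ℚ) → ∃ λ X → 𝔼 f ≤ f X
  𝔼-attained {zero}  f = [] , ≤-refl
  𝔼-attained {suc n} f with ≤-total (𝔼 (λ X → f (inside ∷ X))) (𝔼 (λ X → f (outside ∷ X)))
  ... | inj₁ f₁≤f₀ = let X , 𝔼≤ = 𝔼-attained (λ X → f (outside ∷ X)) in
    outside ∷ X , ≤-trans (≤-trans (+-monoˡ-≤ _ (*-monoˡ p 0≤p f₁≤f₀)) (≤-reflexive (average _))) 𝔼≤
  ... | inj₂ f₀≤f₁ = let X , 𝔼≤ = 𝔼-attained (λ X → f (inside ∷ X)) in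
    inside ∷ X , ≤-trans
      (≤-trans (+-monoʳ-≤ (p * _) (*-monoˡ (1ℚ - p) 0≤1-p f₀≤f₁)) (≤-reflexive (average _))) 𝔼≤

  -- The hypothesis says that `g` ignores whether `v` is in the set, so `g` is independent of that
  -- event, which has probability `p`.
  𝔼-independent : ∀ {n} (v : Fin n) (g : Subset n → ℚ) →
    (∀ X → g (X [ v ]≔ inside) ≡ g (X [ v ]≔ outside)) →
    𝔼 (λ X → indicator (lookup X v) * g X) ≡ p * 𝔼 g
  𝔼-independent zero g indep = begin
    p * 𝔼 (λ X → 1ℚ * g (inside ∷ X)) + (1ℚ - p) * 𝔼 (λ X → 0ℚ * g (outside ∷ X))
      ≡⟨ cong₂ (λ a b → p * a + (1ℚ - p) * b)
           (𝔼-* 1ℚ (λ X → g (inside ∷ X))) (𝔼-* 0ℚ (λ X → g (outside ∷ X))) ⟩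
    p * (1ℚ * A) + (1ℚ - p) * (0ℚ * B)
      ≡⟨ solve 3 (λ p a b → p :* (con 1ℚ :* a) :+ (con 1ℚ :- p) :* (con 0ℚ :* b) :=
           p :* (p :* a :+ (con 1ℚ :- p) :* a)) refl p A B ⟩
    p * (p * A + (1ℚ - p) * A)
      ≡⟨ cong (λ z → p * (p * A + (1ℚ - p) * z)) (𝔼-cong (λ X → indep (inside ∷ X))) ⟩
    p * (p * A + (1ℚ - p) * B) ∎
    where
    open ≡-Reasoning
    A = 𝔼 (λ X → g (inside ∷ X))
    B = 𝔼 (λ X → g (outside ∷ X))
  𝔼-independent (suc v) g indep = trans
    (cong₂ (λ a b → p * a + (1ℚ - p) * b)
      (𝔼-independent v (λ X → g (inside ∷ X)) (λ X → indep (inside ∷ X)))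
      (𝔼-independent v (λ X → g (outside ∷ X)) (λ X → indep (outside ∷ X))))
    (solve 3 (λ p a b → p :* (p :* a) :+ (con 1ℚ :- p) :* (p :* b) := p :* (p :* a :+ (con 1ℚ :- p) :* b))
      refl p (𝔼 (λ X → g (inside ∷ X))) (𝔼 (λ X → g (outside ∷ X))))

  -- The generating function of a binomial variable: each element of `N` contributes an independent
  -- factor of mean 1 - p + pM, every other element the factor 1.
  𝔼-binomial : ∀ {n} M (N : Subset n) → 𝔼 (λ X → M ^ ∣ N ∩ X ∣) ≡ (1ℚ - p + p * M) ^ ∣ N ∣
  𝔼-binomial M []            = refl
  𝔼-binomial M (inside ∷ N)  = begin
    p * 𝔼 (λ X → M * M ^ ∣ N ∩ X ∣) + (1ℚ - p) * 𝔼 (λ X → M ^ ∣ N ∩ X ∣)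
      ≡⟨ cong (λ a → p * a + (1ℚ - p) * A) (𝔼-* M (λ X → M ^ ∣ N ∩ X ∣)) ⟩
    p * (M * A) + (1ℚ - p) * A
      ≡⟨ solve 3 (λ p M a → p :* (M :* a) :+ (con 1ℚ :- p) :* a := (con 1ℚ :- p :+ p :* M) :* a) refl p M A ⟩
    (1ℚ - p + p * M) * A
      ≡⟨ cong ((1ℚ - p + p * M) *_) (𝔼-binomial M N) ⟩
    (1ℚ - p + p * M) * (1ℚ - p + p * M) ^ ∣ N ∣ ∎
    where
    open ≡-Reasoning
    A = 𝔼 (λ X → M ^ ∣ N ∩ X ∣)
  𝔼-binomial M (outside ∷ N) = trans (average (𝔼 (λ X → M ^ ∣ N ∩ X ∣))) (𝔼-binomial M N)

-- Stable sets

∩-[]≔ : ∀ {n} (N X : Subset n) v b → lookup N v ≡ false → N ∩ (X [ v ]≔ b) ≡ N ∩ X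
∩-[]≔ (false ∷ N) (x ∷ X) zero    b refl = refl
∩-[]≔ (s ∷ N)     (x ∷ X) (suc v) b v∉N  = cong ((s ∧ x) ∷_) (∩-[]≔ N X v b v∉N)

kept : ∀ {n} → Digraph n → Subset n → Fin n → Bool
kept G X v = lookup X v ∧ (2 ℕ.* ∣ N⁺ G v ∩ X ∣ ℕ.≤ᵇ outdeg G v)

core : ∀ {n} → Digraph n → Subset n → Subset n
core G X = tabulate (kept G X)

core-stable : ∀ {n} (G : Digraph n) X → Stable G (core G X)
core-stable G X v v∈T = ℕ.≤-trans (ℕ.*-monoʳ-≤ 2 (p⊆q⇒∣p∣≤∣q∣ N∩T⊆N∩X)) (proj₂ (member v∈T))
  where
  member : ∀ {u} → u ∈ core G X → u ∈ X × 2 ℕ.* ∣ N⁺ G u ∩ X ∣ ℕ.≤ outdeg G u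
  -- Abstracting both conjuncts of `kept` reduces the last equation to `false ≡ true` in every case
  -- but one, so a single clause remains.
  member {u} u∈T with lookup X u in u∈X | 2 ℕ.* ∣ N⁺ G u ∩ X ∣ ℕ.≤ᵇ outdeg G u in few
                    | trans (sym (lookup∘tabulate (kept G X) u)) ([]=⇒lookup u∈T)
  ... | true | true | _ = lookup⇒[]= u X u∈X , ℕ.≤ᵇ⇒≤ _ _ (subst 𝕋 (sym few) _)
  N∩T⊆N∩X : N⁺ G v ∩ core G X ⊆ N⁺ G v ∩ X
  N∩T⊆N∩X u∈ = let u∈N , u∈T = x∈p∩q⁻ (N⁺ G v) (core G X) u∈ in x∈p∩q⁺ (u∈N , proj₁ (member u∈T))

stable? : ∀ {n} (G : Digraph n) → Decidable (Stable G)
stable? G T = Fin.all? λ v → (v ∈? T) →-dec (2 ℕ.* ∣ N⁺ G v ∩ T ∣ ℕ.≤? outdeg G v)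

module _ {n} {P : Subset n → Set} (P? : Decidable P) where

  -- No subset has more than `n` elements, so `fuel` bounds the number of strict improvements still
  -- possible; when it is 0, `T` already has `n` elements.
  maximum-from : ∀ fuel T → P T → n ℕ.≤ fuel ℕ.+ ∣ T ∣ → ∃ λ T → P T × (∀ T' → P T' → ∣ T' ∣ ℕ.≤ ∣ T ∣)
  maximum-from zero T PT n≤ = T , PT , λ T' _ → ℕ.≤-trans (∣p∣≤n T') n≤
  maximum-from (suc fuel) T PT n≤ with anySubset? (λ T' → P? T' ×-dec (∣ T ∣ ℕ.<? ∣ T' ∣))
  ... | yes (T' , PT' , T<T') = maximum-from fuel T' PT'
    (ℕ.≤-trans n≤ (ℕ.≤-trans (ℕ.≤-reflexive (sym (ℕ.+-suc fuel ∣ T ∣))) (ℕ.+-monoʳ-≤ fuel T<T')))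
  ... | no  none = T , PT , λ T' PT' → ℕ.≮⇒≥ λ T<T' → none (T' , PT' , T<T')

  maximum : ∀ T → P T → ∃ λ T → P T × (∀ T' → P T' → ∣ T' ∣ ℕ.≤ ∣ T ∣)
  maximum T PT = maximum-from n T PT (ℕ.m≤m+n n ∣ T ∣)

-- The random set argument

-- Since ν is the inverse of μ, the product is μ to the power 2c - d. It is the exponential weight
-- that dominates the indicator of the bad event d < 2c.
1≤μ²ᶜνᵈ : ∀ {μ ν} → 1ℚ ≤ μ → μ * ν ≡ 1ℚ → ∀ c d → d ℕ.≤ 2 ℕ.* c → 1ℚ ≤ (μ ^ 2) ^ c * ν ^ d
1≤μ²ᶜνᵈ {μ} {ν} 1≤μ μν≡1 c d d≤2c = begin
  1ℚ                                  ≤⟨ ^-≥1 1≤μ j ⟩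
  μ ^ j                               ≡⟨ sym (*-identityʳ (μ ^ j)) ⟩
  μ ^ j * 1ℚ                          ≡⟨ cong (μ ^ j *_) (sym (^-inverse μν≡1 d)) ⟩
  μ ^ j * (μ ^ d * ν ^ d)             ≡⟨ sym (*-assoc (μ ^ j) (μ ^ d) (ν ^ d)) ⟩
  μ ^ j * μ ^ d * ν ^ d               ≡⟨ cong (_* ν ^ d) (sym (^-homo-* μ j d)) ⟩
  μ ^ (j ℕ.+ d) * ν ^ d               ≡⟨ cong (λ k → μ ^ k * ν ^ d) (ℕ.m∸n+n≡m d≤2c) ⟩
  μ ^ (2 ℕ.* c) * ν ^ d               ≡⟨ cong (_* ν ^ d) (sym (^-assocʳ μ 2 c)) ⟩
  (μ ^ 2) ^ c * ν ^ d                 ∎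
  where
  open ≤-Reasoning
  j = 2 ℕ.* c ℕ.∸ d

module RandomSet {n} (G : Digraph n) (e : ℚ) (0<e : 0ℚ < e) (e≤½ : e ≤ ½)
  (tail : ∀ v → (1ℚ - e) * (1ℚ - ½ * (e * e)) ^ outdeg G v ≤ e) where

  p μ ν : ℚ
  p = ½ * (1ℚ - e)
  μ = 1ℚ + e
  ν = inv μ

  0≤½ : 0ℚ ≤ ½
  0≤½ = ≤-trans (<⇒≤ 0<e) e≤½

  0≤p : 0ℚ ≤ p
  0≤p = *-nonNeg 0≤½ (p≤q⇒0≤q-p (≤-trans e≤½ ½≤1))

  p≤1 : p ≤ 1ℚ
  p≤1 = ≤-by-diff (½ + ½ * e) (+-mono-≤ 0≤½ (*-nonNeg 0≤½ (<⇒≤ 0<e)))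
    (solve 1 (λ e → con 1ℚ := con ½ :* (con 1ℚ :- e) :+ (con ½ :+ con ½ :* e)) refl e)

  1≤μ : 1ℚ ≤ μ
  1≤μ = ≤-by-diff e (<⇒≤ 0<e) refl

  μν≡1 : μ * ν ≡ 1ℚ
  μν≡1 = inv-inverseʳ (<-≤-trans 0<1 1≤μ)

  0≤ν : 0ℚ ≤ ν
  0≤ν = <⇒≤ (inv-pos (<-≤-trans 0<1 1≤μ))

  open Expectation p 0≤p p≤1

  -- A minorant of the indicator of 2c ≤ d, where c counts the out-neighbours of `v` in `X`: one
  -- minus the weight μ to the power 2c - d. Its expectation has a closed form.
  score : Fin n → Subset n → ℚ
  score v X = 1ℚ + (- ν ^ outdeg G v) * (μ ^ 2) ^ ∣ N⁺ G v ∩ X ∣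

  -- Outside `X` both sides vanish. For a kept vertex the slack is the weight itself, which is
  -- non-negative; for a rejected vertex of `X` the weight is at least 1, so the score is at most 0.
  score≤kept : ∀ v X → indicator (lookup X v) * score v X ≤ indicator (kept G X v)
  score≤kept v X with lookup X v
  ... | false = ≤-reflexive (*-zeroˡ (score v X))
  ... | true with 2 ℕ.* ∣ N⁺ G v ∩ X ∣ ℕ.≤ᵇ outdeg G v in few
  ...   | true = ≤-by-diff (ν ^ d * M) (*-nonNeg (^-nonNeg 0≤ν d) (^-nonNeg (^-nonNeg (≤-trans 0≤1 1≤μ) 2) c))
    (solve 2 (λ a b → con 1ℚ := con 1ℚ :* (con 1ℚ :+ (:- a) :* b) :+ a :* b) refl (ν ^ d) M)
    where
    c = ∣ N⁺ G v ∩ X ∣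
    d = outdeg G v
    M = (μ ^ 2) ^ c
  ...   | false = ≤-by-diff (M * ν ^ d - 1ℚ) (p≤q⇒0≤q-p (1≤μ²ᶜνᵈ 1≤μ μν≡1 c d (ℕ.<⇒≤ (ℕ.≰⇒> λ 2c≤d → subst 𝕋 few (ℕ.≤⇒≤ᵇ 2c≤d)))))
    (solve 2 (λ a b → con 0ℚ := con 1ℚ :* (con 1ℚ :+ (:- a) :* b) :+ (b :* a :- con 1ℚ)) refl (ν ^ d) M)
    where
    c = ∣ N⁺ G v ∩ X ∣
    d = outdeg G v
    M = (μ ^ 2) ^ c

  𝔼-score : ∀ v → 𝔼 (score v) ≡ 1ℚ - (1ℚ - ½ * (e * e)) ^ outdeg G v
  𝔼-score v = begin
    𝔼 (score v)
      ≡⟨ 𝔼-+ (λ _ → 1ℚ) (λ X → (- ν ^ d) * (μ ^ 2) ^ ∣ N⁺ G v ∩ X ∣) ⟩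
    𝔼 {n} (λ _ → 1ℚ) + 𝔼 (λ X → (- ν ^ d) * (μ ^ 2) ^ ∣ N⁺ G v ∩ X ∣)
      ≡⟨ cong₂ _+_ (𝔼-const n 1ℚ) (trans (𝔼-* (- ν ^ d) (λ X → (μ ^ 2) ^ ∣ N⁺ G v ∩ X ∣))
           (cong ((- ν ^ d) *_) (𝔼-binomial (μ ^ 2) (N⁺ G v)))) ⟩
    1ℚ + (- ν ^ d) * (1ℚ - p + p * μ ^ 2) ^ d
      ≡⟨ solve 2 (λ a b → con 1ℚ :+ (:- a) :* b := con 1ℚ :- b :* a) refl (ν ^ d) ((1ℚ - p + p * μ ^ 2) ^ d) ⟩
    1ℚ - (1ℚ - p + p * μ ^ 2) ^ d * ν ^ d
      ≡⟨ cong (λ z → 1ℚ - z) (sym (^-distrib-* (1ℚ - p + p * μ ^ 2) ν d)) ⟩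
    1ℚ - ((1ℚ - p + p * μ ^ 2) * ν) ^ d
      ≡⟨ cong (λ z → 1ℚ - z ^ d) base ⟩
    1ℚ - (1ℚ - ½ * (e * e)) ^ d ∎
    where
    open ≡-Reasoning
    d = outdeg G v
    -- With p = (1 - e)/2 and μ = 1 + e, the mean 1 - p + pμ² factors as (1 - e²/2)(1 + e), and ν
    -- cancels the second factor.
    base : (1ℚ - p + p * μ ^ 2) * ν ≡ 1ℚ - ½ * (e * e)
    base = begin
      (1ℚ - p + p * μ ^ 2) * ν
        ≡⟨ solve 2 (λ e i → let p = con ½ :* (con 1ℚ :- e) ; m = con 1ℚ :+ e in
             (con 1ℚ :- p :+ p :* (m :* (m :* con 1ℚ))) :* i := (con 1ℚ :- con ½ :* (e :* e)) :* (m :* i))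
             refl e ν ⟩
      (1ℚ - ½ * (e * e)) * (μ * ν)
        ≡⟨ cong ((1ℚ - ½ * (e * e)) *_) μν≡1 ⟩
      (1ℚ - ½ * (e * e)) * 1ℚ
        ≡⟨ *-identityʳ _ ⟩
      1ℚ - ½ * (e * e) ∎

  -- A digraph has no loops, so `v` is not among its own out-neighbours and its presence in `X` does
  -- not affect the count.
  score-independent : ∀ v X → score v (X [ v ]≔ inside) ≡ score v (X [ v ]≔ outside)
  score-independent v X = cong (λ Y → 1ℚ + (- ν ^ outdeg G v) * (μ ^ 2) ^ ∣ Y ∣)
    (trans (∩-[]≔ (N⁺ G v) X v inside v∉N) (sym (∩-[]≔ (N⁺ G v) X v outside v∉N)))
    where
    v∉N : lookup (N⁺ G v) v ≡ false
    v∉N = trans (lookup∘tabulate (arc G v) v) (loopless G v)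

  𝔼-kept : ∀ v → ½ - e ≤ 𝔼 (λ X → indicator (kept G X v))
  𝔼-kept v = begin
    ½ - e
      -- The slack here is half the slack in `tail`: p(1 - B) = ½(1 - e) - ½(1 - e)B, and (1 - e)B ≤
      -- e.
      ≤⟨ ≤-by-diff (½ * (e - (1ℚ - e) * B)) (*-nonNeg 0≤½ (p≤q⇒0≤q-p (tail v)))
           (solve 2 (λ e B → con ½ :* (con 1ℚ :- e) :* (con 1ℚ :- B) :=
             (con ½ :- e) :+ con ½ :* (e :- (con 1ℚ :- e) :* B)) refl e B) ⟩
    p * (1ℚ - B)
      ≡⟨ cong (p *_) (sym (𝔼-score v)) ⟩
    p * 𝔼 (score v)
      ≡⟨ sym (𝔼-independent v (score v) (score-independent v)) ⟩
    𝔼 (λ X → indicator (lookup X v) * score v X)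
      ≤⟨ 𝔼-mono (score≤kept v) ⟩
    𝔼 (λ X → indicator (kept G X v)) ∎
    where
    open ≤-Reasoning
    B = (1ℚ - ½ * (e * e)) ^ outdeg G v

  -- First-moment method: by linearity the expected number of kept vertices is at least (½ - e)n,
  -- and some `X` reaches the expectation.
  large-stable : ∃ λ T → Stable G T × (½ - e) * ι n ≤ ι ∣ T ∣
  large-stable = let X , 𝔼≤ = 𝔼-attained (λ X → sum (λ v → indicator (kept G X v))) in
    core G X , core-stable G X , (begin
      (½ - e) * ι n                                  ≡⟨ sym (sum-const n (½ - e)) ⟩
      sum {n} (λ _ → ½ - e)                          ≤⟨ sum-mono 𝔼-kept ⟩
      sum (λ v → 𝔼 (λ X → indicator (kept G X v)))   ≡⟨ sym (𝔼-sum n (λ v X → indicator (kept G X v))) ⟩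
      𝔼 (λ X → sum (λ v → indicator (kept G X v)))   ≤⟨ 𝔼≤ ⟩
      sum (λ v → indicator (kept G X v))             ≡⟨ sym (ι∣tabulate∣ (kept G X)) ⟩
      ι ∣ core G X ∣                                 ∎)
    where open ≤-Reasoning

-- The logarithm

-- A rational form of aₙ ≤ ∏(1 + fₖ) ≤ exp(∑fₖ) ≤ exp(dy) ≤ (1 − y)⁻ᵈ. The factors are consumed in
-- pieces, x and r being what is left of the current 1 + fₖ and of the current 1 − y; each step
-- uses (1 + x)(1 − r) ≤ 1 + (x − r).
module _ {y} (0≤y : 0ℚ ≤ y) (y≤1 : y ≤ 1ℚ) (a f : ℕ → ℚ) (0≤a : ∀ k → 0ℚ ≤ a k) (0≤f : ∀ k → 0ℚ ≤ f k)
  (a₀≤1 : a 0 ≤ 1ℚ) (step : ∀ k → a (suc k) ≤ a k * (1ℚ + f k)) where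

  private
    0≤1-y : 0ℚ ≤ 1ℚ - y
    0≤1-y = p≤q⇒0≤q-p y≤1

    1-r≤1 : ∀ {r} → 0ℚ ≤ r → 1ℚ - r ≤ 1ℚ
    1-r≤1 {r} 0≤r = ≤-by-diff r 0≤r (solve 1 (λ r → con 1ℚ := (con 1ℚ :- r) :+ r) refl r)

    pow = (1ℚ - y) ^_

    0≤pow : ∀ d → 0ℚ ≤ pow d
    0≤pow = ^-nonNeg 0≤1-y

    merge : ∀ {x r A B} → 0ℚ ≤ x → 0ℚ ≤ r → 0ℚ ≤ A → 0ℚ ≤ B →
            A * (1ℚ + x) * ((1ℚ - r) * B) ≤ A * (1ℚ + (x - r)) * B
    merge {x} {r} {A} {B} 0≤x 0≤r 0≤A 0≤B =
      ≤-by-diff (A * (x * r) * B) (*-nonNeg (*-nonNeg 0≤A (*-nonNeg 0≤x 0≤r)) 0≤B)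
        (solve 4 (λ x r A B → A :* (con 1ℚ :+ (x :- r)) :* B :=
          A :* (con 1ℚ :+ x) :* ((con 1ℚ :- r) :* B) :+ A :* (x :* r) :* B) refl x r A B)

    consume : ∀ N d r x → 0ℚ ≤ r → r ≤ 1ℚ → 0ℚ ≤ x → x + Σ< N f ≤ r + ι d * y →
              a N * (1ℚ + x) * ((1ℚ - r) * pow d) ≤ 1ℚ
    consume N d r x 0≤r r≤1 0≤x budget with x ≤? r
    consume zero d r x 0≤r r≤1 0≤x budget | yes x≤r = ≤-trans (merge 0≤x 0≤r (0≤a 0) (0≤pow d))
      (*-mono (*-nonNeg (0≤a 0) 0≤1+x-r) 0≤1 (*-mono (0≤a 0) 0≤1 a₀≤1 1+x-r≤1) (^-≤1 0≤1-y (1-r≤1 0≤y) d))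
      where
      1+x-r≡ : 1ℚ + (x - r) ≡ 1ℚ - (r - x)
      1+x-r≡ = solve 2 (λ x r → con 1ℚ :+ (x :- r) := con 1ℚ :- (r :- x)) refl x r
      1+x-r≤1 : 1ℚ + (x - r) ≤ 1ℚ
      1+x-r≤1 = ≤-trans (≤-reflexive 1+x-r≡) (1-r≤1 (p≤q⇒0≤q-p x≤r))
      0≤1+x-r : 0ℚ ≤ 1ℚ + (x - r)
      0≤1+x-r = ≤-trans (+-mono-≤ 0≤x (p≤q⇒0≤q-p r≤1))
        (≤-reflexive (solve 2 (λ x r → x :+ (con 1ℚ :- r) := con 1ℚ :+ (x :- r)) refl x r))
    consume (suc N) d r x 0≤r r≤1 0≤x budget | yes x≤r = begin
      a (suc N) * (1ℚ + x) * ((1ℚ - r) * pow d)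
        ≤⟨ merge 0≤x 0≤r (0≤a (suc N)) (0≤pow d) ⟩
      a (suc N) * (1ℚ + (x - r)) * pow d
        ≡⟨ solve 4 (λ a x r B → a :* (con 1ℚ :+ (x :- r)) :* B := a :* ((con 1ℚ :- (r :- x)) :* B))
             refl (a (suc N)) x r (pow d) ⟩
      a (suc N) * ((1ℚ - (r - x)) * pow d)
        -- The piece x is used up: `step` opens the next factor 1 + f N, and r - x is left of the
        -- current 1 - y.
        ≤⟨ *-monoʳ _ (*-nonNeg (p≤q⇒0≤q-p r-x≤1) (0≤pow d)) (step N) ⟩
      a N * (1ℚ + f N) * ((1ℚ - (r - x)) * pow d)
        ≤⟨ consume N d (r - x) (f N) (p≤q⇒0≤q-p x≤r) r-x≤1 (0≤f N) budget' ⟩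
      1ℚ ∎
      where
      open ≤-Reasoning
      r-x≤1 : r - x ≤ 1ℚ
      r-x≤1 = ≤-trans (≤-by-diff x 0≤x (solve 2 (λ r x → r := (r :- x) :+ x) refl r x)) r≤1
      budget' : f N + Σ< N f ≤ (r - x) + ι d * y
      budget' = begin
        f N + Σ< N f                ≡⟨ solve 3 (λ x s t → t :+ s := (x :+ (s :+ t)) :- x) refl x (Σ< N f) (f N) ⟩
        (x + (Σ< N f + f N)) - x    ≤⟨ +-monoˡ-≤ (- x) budget ⟩
        (r + ι d * y) - x           ≡⟨ solve 3 (λ x r s → (r :+ s) :- x := (r :- x) :+ s) refl x r (ι d * y) ⟩
        (r - x) + ι d * y           ∎
    -- No further factor 1 - y is available, so the budget is r alone and forces x ≤ r.
    consume N zero r x 0≤r r≤1 0≤x budget | no x≰r = contradiction x≤r x≰r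
      where
      open ≤-Reasoning
      x≤r : x ≤ r
      x≤r = begin
        x              ≤⟨ ≤-by-diff (Σ< N f) (Σ<-nonNeg N 0≤f) refl ⟩
        x + Σ< N f     ≤⟨ budget ⟩
        r + 0ℚ * y     ≡⟨ solve 2 (λ r y → r :+ con 0ℚ :* y := r) refl r y ⟩
        r              ∎
    consume N (suc d) r x 0≤r r≤1 0≤x budget | no x≰r = begin
      a N * (1ℚ + x) * ((1ℚ - r) * pow (suc d))
        ≤⟨ merge 0≤x 0≤r (0≤a N) (0≤pow (suc d)) ⟩
      a N * (1ℚ + (x - r)) * ((1ℚ - y) * pow d)
        -- The piece r is used up: a fresh factor 1 - y is opened, and x - r is left of the current
        -- 1 + fₖ.
        ≤⟨ consume N d y (x - r) 0≤y y≤1 (p≤q⇒0≤q-p (<⇒≤ (≰⇒> x≰r))) budget' ⟩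
      1ℚ ∎
      where
      open ≤-Reasoning
      budget' : (x - r) + Σ< N f ≤ y + ι d * y
      budget' = begin
        (x - r) + Σ< N f            ≡⟨ solve 3 (λ x r s → (x :- r) :+ s := (x :+ s) :- r) refl x r (Σ< N f) ⟩
        (x + Σ< N f) - r            ≤⟨ +-monoˡ-≤ (- r) budget ⟩
        (r + (1ℚ + ι d) * y) - r    ≡⟨ solve 3 (λ r m y → (r :+ (con 1ℚ :+ m) :* y) :- r := y :+ m :* y) refl r (ι d) y ⟩
        y + ι d * y                 ∎

  product≤1 : ∀ N d → Σ< N f ≤ ι d * y → a N * (1ℚ - y) ^ d ≤ 1ℚ
  product≤1 N d budget = ≤-trans
    (≤-reflexive (solve 2 (λ A B → A :* B := A :* (con 1ℚ :+ con 0ℚ) :* ((con 1ℚ :- con 0ℚ) :* B)) refl (a N) (pow d)))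
    -- Both pieces start empty, so their factors are 1.
    (consume N d 0ℚ 0ℚ ≤-refl 0≤1 ≤-refl (+-monoʳ-≤ 0ℚ budget))

module RiemannSum (m : ℕ) (q : ℚ) (1≤q : 1ℚ ≤ q) where

  N = suc m
  i h : ℚ
  i = inv (ι N)
  h = (q - 1ℚ) * i

  node : ℕ → ℚ
  node k = 1ℚ + ι k * h

  0≤h : 0ℚ ≤ h
  0≤h = *-nonNeg (p≤q⇒0≤q-p 1≤q) (<⇒≤ (inv-pos (0<ι m)))

  1≤node : ∀ k → 1ℚ ≤ node k
  1≤node k = ≤-by-diff (ι k * h) (*-nonNeg (0≤ι k) 0≤h) refl

  0<node : ∀ k → 0ℚ < node k
  0<node k = <-≤-trans 0<1 (1≤node k)

  Nh≡q-1 : ι N * h ≡ q - 1ℚ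
  Nh≡q-1 = trans (solve 3 (λ n z i → n :* (z :* i) := z :* (n :* i)) refl (ι N) (q - 1ℚ) i)
    (trans (cong ((q - 1ℚ) *_) (inv-inverseʳ (0<ι m))) (*-identityʳ (q - 1ℚ)))

  node-last : node N ≡ q
  node-last = trans (cong (1ℚ +_) Nh≡q-1) (solve 1 (λ q → con 1ℚ :+ (q :- con 1ℚ) := q) refl q)

  term : ℕ → ℚ
  term k = h * inv (node k)

  0≤term : ∀ k → 0ℚ ≤ term k
  0≤term k = *-nonNeg 0≤h (<⇒≤ (inv-pos (0<node k)))

  -- Adding h to a node multiplies it by 1 + h/node. The terms of the Riemann sum are thus exactly
  -- the growth rates of the nodes, and `step` in `product≤1` holds with equality.
  node-step : ∀ k → node (suc k) ≡ node k * (1ℚ + term k)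
  node-step k = sym (begin
    node k * (1ℚ + h * inv (node k))   ≡⟨ solve 3 (λ a h i → a :* (con 1ℚ :+ h :* i) := a :+ h :* (a :* i))
                                            refl (node k) h (inv (node k)) ⟩
    node k + h * (node k * inv (node k)) ≡⟨ cong (λ z → node k + h * z) (inv-inverseʳ (0<node k)) ⟩
    node k + h * 1ℚ                    ≡⟨ solve 2 (λ m h → (con 1ℚ :+ m :* h) :+ h :* con 1ℚ :=
                                            con 1ℚ :+ (con 1ℚ :+ m) :* h) refl (ι k) h ⟩
    node (suc k)                       ∎)
    where open ≡-Reasoning

  -- The discrete form of log q ≥ 1 - 1/q: the integrand 1/t is at least 1/q at every node.
  q-1≤q*riemann : q - 1ℚ ≤ q * riemann N q
  q-1≤q*riemann = begin
    q - 1ℚ                      ≡⟨ sym Nh≡q-1 ⟩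
    ι N * h                     ≡⟨ sym (*-identityˡ (ι N * h)) ⟩
    1ℚ * (ι N * h)              ≡⟨ cong (_* (ι N * h)) (sym (inv-inverseʳ 0<q)) ⟩
    q * inv q * (ι N * h)       ≡⟨ solve 4 (λ q j n h → q :* j :* (n :* h) := q :* (n :* (h :* j))) refl q (inv q) (ι N) h ⟩
    q * (ι N * (h * inv q))     ≤⟨ *-monoˡ q (<⇒≤ 0<q) (Σ<-lower N λ k k<N → *-monoˡ h 0≤h
                                     (inv-anti (0<node k) (node≤q k (ℕ.<⇒≤ k<N)))) ⟩
    q * riemann N q             ∎
    where
    open ≤-Reasoning
    0<q = <-≤-trans 0<1 1≤q
    node≤q : ∀ k → k ℕ.≤ N → node k ≤ q
    node≤q k k≤N = ≤-trans (+-monoʳ-≤ 1ℚ (*-monoʳ h 0≤h (ι-mono k≤N))) (≤-reflexive node-last)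

  -- The product bound applied to the nodes, which grow from 1 to q, with the terms of the sum as
  -- `f`. It turns an upper bound on the Riemann sum into one on q without using an exponential
  -- function.
  q*[1-y]^d≤1 : ∀ {y} d → 0ℚ ≤ y → y ≤ 1ℚ → riemann N q ≤ ι d * y → q * (1ℚ - y) ^ d ≤ 1ℚ
  q*[1-y]^d≤1 {y} d 0≤y y≤1 R≤dy = subst (λ z → z * (1ℚ - y) ^ d ≤ 1ℚ) node-last
    (product≤1 0≤y y≤1 node term (λ k → <⇒≤ (0<node k)) 0≤term
      (≤-reflexive (solve 1 (λ h → con 1ℚ :+ con 0ℚ :* h := con 1ℚ) refl h))
      (λ k → ≤-reflexive (node-step k)) N d R≤dy)

-- The gap η between e and ½ bounds the logarithm from below, so that the spare factor 2 − e absorbs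
-- an error η in the degree hypothesis.
tail-bound : ∀ e η m d → 0ℚ < e → 0ℚ ≤ η → e + η ≤ ½ →
  ι 2 * (inv e * inv e) * (ι 2 - e) * riemann (suc m) ((ι 1 - e) * inv e) ≤ ι d + η →
  (1ℚ - e) * (1ℚ - ½ * (e * e)) ^ d ≤ e
tail-bound e η m d 0<e 0≤η e+η≤½ deg = begin
  (1ℚ - e) * B               ≡⟨ cong (_* B) (sym (cancel (1ℚ - e))) ⟩
  e * q * B                  ≡⟨ *-assoc e q B ⟩
  e * (q * B)                ≤⟨ *-monoˡ e 0≤e (q*[1-y]^d≤1 d 0≤y y≤1 R≤dy) ⟩
  e * 1ℚ                     ≡⟨ *-identityʳ e ⟩
  e                          ∎
  where
  open ≤-Reasoning
  i q y B R : ℚ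
  i = inv e
  q = (1ℚ - e) * i
  y = ½ * (e * e)
  B = (1ℚ - y) ^ d
  R = riemann (suc m) q

  0≤e = <⇒≤ 0<e
  e≤½ : e ≤ ½
  e≤½ = ≤-trans (≤-by-diff η 0≤η refl) e+η≤½
  e≤1 = ≤-trans e≤½ ½≤1
  ei≡1 : e * i ≡ 1ℚ
  ei≡1 = inv-inverseʳ 0<e
  1≤i : 1ℚ ≤ i
  1≤i = inv-anti 0<e e≤1
  0≤i = ≤-trans 0≤1 1≤i
  0≤½ = ≤-trans 0≤e e≤½
  0≤y : 0ℚ ≤ y
  0≤y = *-nonNeg 0≤½ (*-nonNeg 0≤e 0≤e)
  y≤1 : y ≤ 1ℚ
  y≤1 = *-mono 0≤½ 0≤1 ½≤1 (*-mono 0≤e 0≤1 e≤1 e≤1)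

  cancel : ∀ c → e * (c * i) ≡ c
  cancel c = trans (solve 3 (λ e c i → e :* (c :* i) := c :* (e :* i)) refl e c i)
    (trans (cong (c *_) ei≡1) (*-identityʳ c))

  e+e≤1 : e + e ≤ 1ℚ
  e+e≤1 = +-mono-≤ e≤½ e≤½

  1≤q : 1ℚ ≤ q
  1≤q = begin
    1ℚ             ≡⟨ sym ei≡1 ⟩
    e * i          ≤⟨ *-monoʳ i 0≤i (≤-by-diff {e} (1ℚ - (e + e)) (p≤q⇒0≤q-p e+e≤1)
                        (solve 1 (λ e → con 1ℚ :- e := e :+ (con 1ℚ :- (e :+ e))) refl e)) ⟩
    (1ℚ - e) * i   ∎

  open RiemannSum m q 1≤q using (q-1≤q*riemann; q*[1-y]^d≤1)

  -- As eq = 1 - e, multiplying q - 1 ≤ qR by e gives 1 - 2e ≤ (1 - e)R, and e + η ≤ ½ gives 2η ≤ 1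
  -- - 2e.
  [1-e]R≥2η : η + η ≤ (1ℚ - e) * R
  [1-e]R≥2η = begin
    η + η              ≤⟨ ≤-by-diff ((½ - (e + η)) + (½ - (e + η)))
                            (+-mono-≤ (p≤q⇒0≤q-p e+η≤½) (p≤q⇒0≤q-p e+η≤½))
                            (solve 2 (λ e h → (con 1ℚ :- e) :- e :=
                              (h :+ h) :+ ((con ½ :- (e :+ h)) :+ (con ½ :- (e :+ h)))) refl e η) ⟩
    (1ℚ - e) - e       ≡⟨ cong₂ _-_ (sym (cancel (1ℚ - e))) (sym (*-identityʳ e)) ⟩
    e * q - e * 1ℚ     ≡⟨ solve 2 (λ e q → e :* q :- e :* con 1ℚ := e :* (q :- con 1ℚ)) refl e q ⟩
    e * (q - 1ℚ)       ≤⟨ *-monoˡ e 0≤e q-1≤q*riemann ⟩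
    e * (q * R)        ≡⟨ sym (*-assoc e q R) ⟩
    e * q * R          ≡⟨ cong (_* R) (cancel (1ℚ - e)) ⟩
    (1ℚ - e) * R       ∎

  -- Split 2 - e as 1 + (1 - e). The part 2i²(1 - e)R is at least 4η because i ≥ 1, so it pays for
  -- the error η in `deg`, and the part 2i²R remains.
  2i²R≤d : ι 2 * (i * i) * R ≤ ι d
  2i²R≤d = begin
    ι 2 * (i * i) * R
      ≡⟨ solve 3 (λ i e R → con (ι 2) :* (i :* i) :* R :=
           con (ι 2) :* (i :* i) :* (con (ι 2) :- e) :* R :-
           (i :* i) :* (con (ι 2) :* ((con 1ℚ :- e) :* R))) refl i e R ⟩
    ι 2 * (i * i) * (ι 2 - e) * R - (i * i) * (ι 2 * ((1ℚ - e) * R))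
      ≤⟨ +-mono-≤ deg (neg-antimono-≤ η≤) ⟩
    (ι d + η) - η
      ≡⟨ solve 2 (λ d h → (d :+ h) :- h := d) refl (ι d) η ⟩
    ι d ∎
    where
    η≤ : η ≤ (i * i) * (ι 2 * ((1ℚ - e) * R))
    η≤ = begin
      η                                  ≤⟨ ≤-by-diff (η + η + η) (+-mono-≤ (+-mono-≤ 0≤η 0≤η) 0≤η)
                                              (solve 1 (λ h → con 1ℚ :* (con (ι 2) :* (h :+ h)) := h :+ (h :+ h :+ h)) refl η) ⟩
      1ℚ * (ι 2 * (η + η))               ≤⟨ *-mono 0≤1 (*-nonNeg (0≤ι 2) (≤-trans (+-mono-≤ 0≤η 0≤η) [1-e]R≥2η))
                                              (*-mono 0≤1 0≤i 1≤i 1≤i) (*-monoˡ (ι 2) (0≤ι 2) [1-e]R≥2η) ⟩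
      (i * i) * (ι 2 * ((1ℚ - e) * R))   ∎

  R≤dy : R ≤ ι d * y
  R≤dy = begin
    R                            ≡⟨ sym (trans (cong₂ (λ a b → a * (b * R)) ei≡1 ei≡1)
                                      (solve 1 (λ r → con 1ℚ :* (con 1ℚ :* r) := r) refl R)) ⟩
    (e * i) * ((e * i) * R)      ≡⟨ solve 3 (λ e i R → (e :* i) :* ((e :* i) :* R) :=
                                      con (ι 2) :* (i :* i) :* R :* (con ½ :* (e :* e))) refl e i R ⟩
    ι 2 * (i * i) * R * y        ≤⟨ *-monoʳ y 0≤y 2i²R≤d ⟩
    ι d * y                      ∎

-- Passage from rational approximations to the real ε

upper-bound : ∀ {n} (f : Fin n → ℕ) → ∃ λ N → ∀ v → f v ℕ.≤ N
upper-bound {zero}  f = 0 , λ ()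
upper-bound {suc n} f = let N , f≤N = upper-bound (λ v → f (suc v)) in
  f zero ℕ.⊔ N , λ { zero    → ℕ.m≤m⊔n (f zero) N
                   ; (suc v) → ℕ.≤-trans (f≤N v) (ℕ.m≤n⊔m (f zero) N) }

proposition8 : (ε : ℝ) (0<ε : 0ᴿ <ᴿ ε) (ε<½ : ε <ᴿ ½ᴿ) →
    (n : ℕ) (G : Digraph n) →
    MinOutdegree≥ G
    (2ᴿ *ᴿ (recip ε 0<ε *ᴿ recip ε 0<ε) *ᴿ (2ᴿ -ᴿ ε)
    *ᴿ log ((1ᴿ -ᴿ ε) *ᴿ recip ε 0<ε) (odds-pos ε 0<ε ε<½)) →
    ∃ λ (T : Subset n) → Stable G T × ((½ᴿ -ᴿ ε) *ᴿ fromℕ n ≤ᴿ fromℕ ∣ T ∣)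
proposition8 ε 0<ε@(δ , 0<δ , N₁ , ε≥δ) (η , 0<η , N₂ , ε≤½-η) n G mindeg =
  -- The empty set is vacuously stable, so the search for a maximum starts there.
  let T , T-stable , T-max = maximum (stable? G) ⊥ (λ v v∈⊥ → contradiction v∈⊥ ∉⊥)
      -- The degree hypothesis is read with error η, the gap between ε and ½. Its threshold index
      -- depends on the vertex, hence the bound over all vertices.
      N₃ , N₃-bound = upper-bound (λ v → proj₁ (mindeg v η 0<η))
      N = N₁ ℕ.⊔ N₂ ℕ.⊔ N₃ in
  -- The threshold N is independent of ζ: from N on the inequality holds for each approximation
  -- without error. The set T' found below varies with k, while `T` is fixed and at least as large.
  T , T-stable , λ ζ 0<ζ → N , λ k N≤k →
    let N₁⊔N₂≤k = ℕ.≤-trans (ℕ.m≤m⊔n (N₁ ℕ.⊔ N₂) N₃) N≤k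
        N₁≤k = ℕ.≤-trans (ℕ.m≤m⊔n N₁ N₂) N₁⊔N₂≤k
        N₂≤k = ℕ.≤-trans (ℕ.m≤n⊔m N₁ N₂) N₁⊔N₂≤k
        N₃≤k = ℕ.≤-trans (ℕ.m≤n⊔m (N₁ ℕ.⊔ N₂) N₃) N≤k
        e = seq ε k
        0<e = <-≤-trans 0<δ (≤-trans (≤-reflexive (sym (+-identityˡ δ))) (ε≥δ k N₁≤k))
        e+η≤½ = ε≤½-η k N₂≤k
        T' , T'-stable , T'-large = RandomSet.large-stable G e 0<e
          (≤-trans (≤-by-diff η (<⇒≤ 0<η) refl) e+η≤½)
          (λ v → tail-bound e η k (outdeg G v) 0<e (<⇒≤ 0<η) e+η≤½
            (proj₂ (mindeg v η 0<η) k (ℕ.≤-trans (N₃-bound v) N₃≤k)))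
    in ≤-trans T'-large (≤-trans (ι-mono (T-max T' T'-stable)) (≤-by-diff ζ (<⇒≤ 0<ζ) refl))
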